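{- Let $i\ge 3$ and $k\ge 3$ be integers. Then: (a) $n_3(F_i,F_{i+2},F_{i+k})=\tfrac12\bigl(7F_iF_{i+2}-F_i-F_{i+2}+1\bigr)$ whenever $k\ge i+3$; (b) $n_3(F_i,F_{i+2},F_{2i})=\tfrac12\bigl((5F_i-1)F_{i+2}-F_i+1\bigr)-2F_iF_{i-2}$; (c) $n_3(F_i,F_{i+2},F_{2i-1})=\tfrac12\bigl((F_i+4F_{i-1}-1)F_{i+2}-F_i+1\bigr)-2F_{i-1}F_{i-3}$ for $i\ge 4$; (d) $n_3(F_i,F_{i+2},F_{2i-2})=\tfrac12\bigl((3F_i-1)F_{i+2}-F_i+1\bigr)-(8F_i-15F_{i-2})F_{i-4}$ for $i\ge 5$; (e) if $r=\lfloor (F_i-1)/F_k\rfloor\ge 3$ (equivalently $k\le i-3$), then $$n_3(F_i,F_{i+2},F_{i+k})=\tfrac12\bigl((F_i+6F_k-1)F_{i+2}-F_i+1\bigr)-\tfrac12\bigl(2rF_i-(r+4)(r-3)F_k\bigr)F_{k-2}.$$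
   Context: Fibonacci numbers: $F_0=0$, $F_1=1$, $F_n=F_{n-1}+F_{n-2}$. For positive integers $a_1,\dots,a_l$ with $\gcd(a_1,\dots,a_l)=1$ and an integer $n$, let $d(n;a_1,\dots,a_l)$ be the number of tuples $(x_1,\dots,x_l)$ of nonnegative integers with $a_1x_1+\dots+a_lx_l=n$. For a nonnegative integer $p$, the $p$-Sylvester number $n_p(a_1,\dots,a_l)$ is the number of nonnegative integers $n$ with $d(n;a_1,\dots,a_l)\le p$. -}

module Defs where

open import Data.Fin.Base using (Fin)
open import Data.Integer.Base as ℤ using (ℤ; +_)
open import Data.List.Base using (List; []; _∷_; cartesianProductWith; filter; length; upTo)
open import Data.List.Membership.Propositional using (_∈_)
open import Data.List.Membership.Propositional.Properties
  using (∈-filter⁺; ∈-filter⁻; ∈-upTo⁺; ∈-cartesianProductWith⁺)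
open import Data.List.Relation.Unary.All using ([])
open import Data.List.Relation.Unary.AllPairs using ([]; _∷_)
open import Data.List.Relation.Unary.Any using (here)
open import Data.List.Relation.Unary.Unique.Propositional using (Unique)
import Data.List.Relation.Unary.Unique.Propositional.Properties as Unique
open import Data.Nat.Base
open import Data.Nat.Properties
open import Data.Product.Base using (Σ-syntax; _×_; _,_; proj₂)
open import Data.Rational.Base as ℚ using (ℚ)
open import Data.Vec.Base as Vec using (Vec; []; _∷_)
open import Data.Vec.Properties using (∷-injective)
open import Data.Vec.Relation.Unary.All using (All; []; _∷_)
open import Function.Bundles using (_↔_; _⇔_; mk⇔)
open import Relation.Binary.PropositionalEquality using (_≡_; refl)

fib : ℕ → ℕ
fib 0             = 0
fib 1             = 1
fib (suc (suc n)) = fib (suc n) + fib n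

fib-positive : ∀ n → 0 < fib (suc n)
fib-positive zero    = z<s
fib-positive (suc n) = <-≤-trans (fib-positive n) (m≤m+n (fib (suc n)) (fib n))

fib-nonZero : ∀ {k} → 3 ≤ k → NonZero (fib k)
fib-nonZero {suc k} _ = >-nonZero (fib-positive k)

infix 7 _·_

_·_ : ∀ {l} → Vec ℕ l → Vec ℕ l → ℕ
a · x = Vec.sum (Vec.zipWith _*_ a x)

box : ∀ l → ℕ → List (Vec ℕ l)
box zero    n = [] ∷ []
box (suc l) n = cartesianProductWith _∷_ (upTo (suc n)) (box l n)

-- For positive a, any x with a · x ≡ n has all its entries at most n, so
-- restricting the search to the box loses nothing; see ∈-solutions below.
solutions : ∀ {l} → Vec ℕ l → ℕ → List (Vec ℕ l)
solutions {l} a n = filter (λ x → a · x ≟ n) (box l n)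

d : ∀ {l} → ℕ → Vec ℕ l → ℕ
d n a = length (solutions a n)

-- "n_p(a) = N". When the a_j are positive with greatest common divisor 1 the
-- set on the right is finite, and N is then uniquely determined.
IsSylvesterNumber : ∀ {l} → ℕ → Vec ℕ l → ℕ → Set
IsSylvesterNumber p a N = Fin N ↔ (Σ[ n ∈ ℕ ] d n a ≤ p)

ι : ℤ → ℚ
ι z = z ℚ./ 1

-- "n_p(a) = q", where the right-hand side q is a rational expression.
SylvesterNumberEquals : ∀ {l} → ℕ → Vec ℕ l → ℚ → Set
SylvesterNumberEquals p a q = Σ[ N ∈ ℕ ] IsSylvesterNumber p a N × ι (+ N) ≡ q

F : ℕ → ℤ
F n = + fib n

∈-box : ∀ {l} (a x : Vec ℕ l) n → All (0 <_) a → a · x ≤ n → x ∈ box l n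
∈-box []      []      n _            _    = here refl
∈-box (c ∷ a) (y ∷ x) n (0<c ∷ 0<a) ax≤n =
  ∈-cartesianProductWith⁺ _∷_
    (∈-upTo⁺ (s≤s (≤-trans (m≤n*m y c {{>-nonZero 0<c}}) (≤-trans (m≤m+n (c * y) (a · x)) ax≤n))))
    (∈-box a x n 0<a (≤-trans (m≤n+m (a · x) (c * y)) ax≤n))

∈-solutions : ∀ {l} (a : Vec ℕ l) n → All (0 <_) a → ∀ x → x ∈ solutions a n ⇔ a · x ≡ n
∈-solutions {l} a n 0<a x = mk⇔
  (λ x∈ → proj₂ (∈-filter⁻ (λ x → a · x ≟ n) {xs = box l n} x∈))
  (λ eq → ∈-filter⁺ (λ x → a · x ≟ n) (∈-box a x n 0<a (≤-reflexive eq)) eq)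

box-unique : ∀ l n → Unique (box l n)
box-unique zero    n = [] ∷ []
box-unique (suc l) n =
  Unique.cartesianProductWith⁺ _∷_ ∷-injective (Unique.upTo⁺ (suc n)) (box-unique l n)

solutions-unique : ∀ {l} (a : Vec ℕ l) n → Unique (solutions a n)
solutions-unique {l} a n = Unique.filter⁺ (λ x → a · x ≟ n) (box-unique l n)

module Submission where

-- Write a = F i, b = F (i + 2), c = F (i + k), q = F k and g = F (k - 2), so that
-- c + g a = q b.  If n ≡ ρ b (mod a) with 0 ≤ ρ < a, a representation
-- n = a x + b y + c z has y + z q = ρ + t a for some t ≥ 0, and then
-- n = ρ b + a (x + t b - z g).  Representations of n are therefore the lattice
-- points (t , z) with z q ≤ ρ + t a whose weight t b - z g is at most (n - ρ b) / a,
-- and d n ≤ 3 says that n is below the value of the fourth lightest point for ρ.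
-- Counting these n residue by residue gives
--   2 N + 2 g ∑ z + a + b = a b + 1 + 2 b ∑ t,
-- the sums running over the fourth lightest points (t , z) for 0 ≤ ρ < a.
-- If k ≥ i + 3, that point is always (3 , 0).  In the other cases 4 q g ≤ c; then the
-- four lightest points of a row t are no heavier than any point of a later row, and
-- the fourth lightest point is determined by the row lengths ⌊(ρ + t a) / q⌋.

open import Defs
open import Data.Nat as ℕ using (ℕ; _≤_; _∸_)

-- For fixed `ρ` all represented numbers are congruent to `ρ b` modulo `a`, so the class holds
-- `⌊v / a⌋` numbers below a threshold value `v`, and for the value of `(t , z)` this is
-- `⌊ρ b / a⌋ + t b - z g`. Since `∑ ⌊ρ b / a⌋ = (a - 1) (b - 1) / 2`, each formula carries the
-- terms `- a - b + 1`. Only the weight of the fourth point matters, so ties between points do no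
-- harm. The obstacle is to know which point is fourth, because weights of different rows could
-- interleave; the inequalities between `q`, `g` and `c` exclude this. What remains depends on the
-- size of `a / q`. If `4 a ≤ q`, rows 0 to 3 hold one point each. If `q = a`, row `t` holds `t + 1`
-- points. For `k = i - 1` the fourth point leaves row 2 for row 1 at `ρ = g`, because
-- `a + g = 2 q`. For `k = i - 2`, `2 q ≤ a ≤ 3 q` keeps it in row 1. For `k ≤ i - 3` it lies in row
-- 1 while `ρ < 3 q` and in row 0 afterwards. The counts are proved as doubled equations over the
-- naturals, with every subtracted term moved across; halves and differences return only in the
-- rational formulas.

module _ where
  open import Data.Nat using (zero; suc; _<_; _+_; _*_; NonZero; >-nonZero; >-nonZero⁻¹; z≤n; s≤s; s≤s⁻¹)
  open import Data.Nat.Properties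
  open import Data.Nat.DivMod
  open import Data.Nat.Divisibility using (_∣_; divides; ∣⇒≤; ∣-refl; n∣m*n)
  open import Data.Nat.Coprimality as Coprimality using (Coprime; coprime-divisor; coprime-+; 1-coprimeTo)
  open import Data.Nat.Solver using (module +-*-Solver)
  open +-*-Solver using (solve; _:=_; _:+_; _:*_; con)
  open import Data.Fin using (Fin; zero; suc; toℕ; fromℕ<; punchOut)
  open import Data.Fin.Properties as Fin
    using (any?; injective⇒≤; punchOut-injective; toℕ<n; toℕ-fromℕ<; toℕ-injective; +↔⊎)
  open import Data.Fin.Permutation using (Permutation; permutation; flip; _⟨$⟩ˡ_; inverseʳ)
  open import Data.List using (List; []; _∷_; length; lookup; map)
  open import Data.List.Properties using (length-map)
  open import Data.List.Membership.Propositional using (_∈_)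
  open import Data.List.Membership.Propositional.Properties using (∈-lookup; ∈-map⁺)
  open import Data.List.Relation.Unary.All as All using (All; []; _∷_)
  open import Data.List.Relation.Unary.AllPairs using ([]; _∷_)
  open import Data.List.Relation.Unary.Any using (here; there; index)
  open import Data.List.Relation.Unary.Any.Properties using (lookup-index)
  open import Data.List.Relation.Unary.Unique.Propositional using (Unique)
  open import Data.Product using (Σ-syntax; ∃-syntax; _×_; _,_; proj₁; proj₂)
  open import Data.Sum using (_⊎_; inj₁; inj₂)
  open import Data.Sum.Function.Propositional using (_⊎-↔_)
  open import Data.Vec using (Vec; []; _∷_)
  open import Data.Vec.Properties using (∷-injective)
  import Data.Vec.Relation.Unary.All as VecAll
  open import Algebra.Properties.Semiring.Sum +-*-semiring
    using (sum; sum-cong-≗; ∑-distrib-+; sum-permute; *-distribʳ-sum)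
  open import Function using (_∘_; id; _⇔_; mk⇔; _↔_; mk↔ₛ′; Injective; Equivalence)
  open import Function.Properties.Inverse using (↔-trans; ↔-refl)
  open import Relation.Nullary using (yes; no; contradiction)
  open import Relation.Binary.PropositionalEquality using (_≡_; refl; sym; trans; cong; cong₂; subst; subst₂)

  -- Counting by residue classes

  lookup-injective : ∀ {A : Set} {xs : List A} → Unique xs → Injective _≡_ _≡_ (lookup xs)
  lookup-injective (px ∷ u) {zero}  {zero}  _  = refl
  lookup-injective {xs = x ∷ xs} (px ∷ u) {zero}  {suc j} eq = contradiction eq (All.lookup px (∈-lookup j))
  lookup-injective {xs = x ∷ xs} (px ∷ u) {suc i} {zero}  eq = contradiction (sym eq) (All.lookup px (∈-lookup i))
  lookup-injective (px ∷ u) {suc i} {suc j} eq = cong suc (lookup-injective u eq)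

  -- Both bounds on `d` come from here: distinct points inject into the solutions, and the solutions
  -- embed into a list of points. Injectivity is asked on members only, because `toVec` is injective
  -- only on valid points.
  injection-length : ∀ {A B : Set} {xs : List A} {ys : List B} (f : A → B) → Unique xs →
    (∀ {x} → x ∈ xs → f x ∈ ys) → (∀ {x y} → x ∈ xs → y ∈ xs → f x ≡ f y → x ≡ y) →
    length xs ≤ length ys
  injection-length {xs = xs} {ys} f u f∈ inj = injective⇒≤ {f = λ i → index (f∈ (∈-lookup i))}
    λ {i} {j} eq → lookup-injective u (inj (∈-lookup i) (∈-lookup j)
      (trans (lookup-index (f∈ (∈-lookup i)))
        (trans (cong (lookup ys) eq) (sym (lookup-index (f∈ (∈-lookup j)))))))

  -- Pigeonhole: if `y` were missed, punching it out of the codomain would inject `Fin (suc n)` into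
  -- `Fin n`.
  injective⇒surjective : ∀ {n} (f : Fin n → Fin n) → Injective _≡_ _≡_ f → ∀ y → ∃[ x ] f x ≡ y
  injective⇒surjective {suc n} f inj y with any? (λ x → f x Fin.≟ y)
  ... | yes hit = hit
  ... | no miss = contradiction
    (injective⇒≤ {f = λ x → punchOut {i = y} (λ eq → miss (x , sym eq))}
      (λ {x} {x′} eq → inj (punchOut-injective (λ e → miss (x , sym e)) (λ e → miss (x′ , sym e)) eq)))
    1+n≰n

  injective⇒permutation : ∀ {n} (f : Fin n → Fin n) → Injective _≡_ _≡_ f → Permutation n n
  injective⇒permutation f inj = permutation f (proj₁ ∘ surj) (proj₂ ∘ surj)
    (λ x → inj (proj₂ (surj (f x))))
    where surj = injective⇒surjective f inj

  sum↔Σ : ∀ {n} (k : Fin n → ℕ) → Fin (sum k) ↔ (Σ[ i ∈ Fin n ] Fin (k i))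
  sum↔Σ {zero}  k = mk↔ₛ′ (λ ()) (λ ()) (λ ()) (λ ())
  sum↔Σ {suc n} k = ↔-trans +↔⊎ (↔-trans (↔-refl ⊎-↔ sum↔Σ (k ∘ suc)) cons)
    where
    cons : (Fin (k zero) ⊎ (Σ[ i ∈ Fin n ] Fin (k (suc i)))) ↔ (Σ[ i ∈ Fin (suc n) ] Fin (k i))
    cons = mk↔ₛ′
      (λ { (inj₁ j) → zero , j ; (inj₂ (i , j)) → suc i , j })
      (λ { (zero , j) → inj₁ j ; (suc i , j) → inj₂ (i , j) })
      (λ { (zero , j) → refl ; (suc i , j) → refl })
      (λ { (inj₁ j) → refl ; (inj₂ (i , j)) → refl })

  Σ-Fin-≡ : ∀ {n} (k : Fin n → ℕ) {i i′} {j : Fin (k i)} {j′ : Fin (k i′)} →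
    i ≡ i′ → toℕ j ≡ toℕ j′ → (i , j) ≡ (i′ , j′)
  Σ-Fin-≡ k refl eq = cong (_ ,_) (toℕ-injective eq)

  [r+qa]%a : ∀ {a} .{{_ : NonZero a}} r q → r < a → (r + q * a) % a ≡ r
  [r+qa]%a r q r<a = trans ([m+kn]%n≡m%n r q _) (m<n⇒m%n≡m r<a)

  [r+qa]/a : ∀ {a} .{{_ : NonZero a}} r q → r < a → (r + q * a) / a ≡ q
  [r+qa]/a {a} r q r<a = trans (+-distrib-/-∣ʳ r (n∣m*n q))
    (cong₂ ℕ._+_ (m<n⇒m/n≡0 r<a) (m*n/n≡m q a))

  toℕ-mod : ∀ n a .{{_ : NonZero a}} → toℕ (n mod a) ≡ n % a
  toℕ-mod n a = toℕ-fromℕ< (m%n<n n a)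

  -- Writing `n = r + j a`, the class of `r` contributes exactly the `j < k r`. Proofs of `D n ≤ p`
  -- are irrelevant, so counting the numbers `n` counts the pairs.
  count-by-residue : ∀ a .{{_ : NonZero a}} (D : ℕ → ℕ) p (k : Fin a → ℕ) →
    (∀ n → D n ≤ p ⇔ n / a < k (n mod a)) → Fin (sum k) ↔ (Σ[ n ∈ ℕ ] D n ≤ p)
  count-by-residue a D p k char = ↔-trans (sum↔Σ k) (mk↔ₛ′ to from to-from from-to)
    where
    elem : (Σ[ r ∈ Fin a ] Fin (k r)) → ℕ
    elem (r , j) = toℕ r + toℕ j * a
    residue : ∀ x → elem x mod a ≡ proj₁ x
    residue (r , j) = toℕ-injective (trans (toℕ-mod (elem (r , j)) a) ([r+qa]%a (toℕ r) (toℕ j) (toℕ<n r)))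
    quotient : ∀ x → elem x / a ≡ toℕ (proj₂ x)
    quotient (r , j) = [r+qa]/a (toℕ r) (toℕ j) (toℕ<n r)
    to : (Σ[ r ∈ Fin a ] Fin (k r)) → Σ[ n ∈ ℕ ] D n ≤ p
    to x = elem x , char (elem x) .Equivalence.from
      (subst₂ _<_ (sym (quotient x)) (cong k (sym (residue x))) (toℕ<n (proj₂ x)))
    from : (Σ[ n ∈ ℕ ] D n ≤ p) → Σ[ r ∈ Fin a ] Fin (k r)
    from (n , Dn≤p) = n mod a , fromℕ< (char n .Equivalence.to Dn≤p)
    Σ-≤-≡ : ∀ {n n′} {u : D n ≤ p} {u′ : D n′ ≤ p} → n ≡ n′ → (n , u) ≡ (n′ , u′)
    Σ-≤-≡ refl = cong (_ ,_) (≤-irrelevant _ _)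
    to-from : ∀ y → to (from y) ≡ y
    to-from (n , Dn≤p) = Σ-≤-≡ (trans
      (cong₂ (λ r q → r + q * a) (toℕ-mod n a) (toℕ-fromℕ< (char n .Equivalence.to Dn≤p)))
      (sym (m≡m%n+[m/n]*n n a)))
    from-to : ∀ x → from (to x) ≡ x
    from-to x = Σ-Fin-≡ k (residue x)
      (trans (toℕ-fromℕ< (char (elem x) .Equivalence.to (proj₂ (to x)))) (quotient x))

  module _ {a : ℕ} .{{_ : NonZero a}} where

    %-≡∧/-≤⇒≤ : ∀ {m n} → m % a ≡ n % a → m / a ≤ n / a → m ≤ n
    %-≡∧/-≤⇒≤ {m} {n} r≡ q≤ = subst₂ _≤_ (sym (m≡m%n+[m/n]*n m a)) (sym (m≡m%n+[m/n]*n n a))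
      (+-mono-≤ (≤-reflexive r≡) (*-monoˡ-≤ a q≤))

    /-<⇒< : ∀ {m n} → m / a < n / a → m < n
    /-<⇒< q< = ≰⇒> λ n≤m → <⇒≱ q< (/-monoˡ-≤ a n≤m)

    %-≡∧≤⇒shift : ∀ {m n} → m % a ≡ n % a → m ≤ n → ∃[ x ] n ≡ m + x * a
    %-≡∧≤⇒shift {m} {n} r≡ m≤n = n / a ∸ m / a , (begin-equality
      n                                        ≡⟨ m≡m%n+[m/n]*n n a ⟩
      n % a + (n / a) * a                      ≡⟨ cong₂ (λ r q → r
          + q * a) (sym r≡) (sym (m+[n∸m]≡n (/-monoˡ-≤ a m≤n))) ⟩
      m % a + (m / a + (n / a ∸ m / a)) * a    ≡⟨ regroup (m % a) (m / a) (n / a ∸ m / a) ⟩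
      m % a + (m / a) * a + (n / a ∸ m / a) * a ≡⟨ cong (_+ (n / a ∸ m / a) * a) (sym (m≡m%n+[m/n]*n m a)) ⟩
      m + (n / a ∸ m / a) * a                  ∎)
      where
      open ≤-Reasoning
      regroup : ∀ r u x → r + (u + x) * a ≡ r + u * a + x * a
      regroup r u x = trans (cong (r +_) (*-distribʳ-+ a u x)) (sym (+-assoc r _ _))

    -- The difference `(σ - ρ) b` is a multiple of `a`, so by coprimality `a` divides `σ ∸ ρ`, which
    -- is smaller than `a`.
    %-cancel-≤ : ∀ {b ρ σ} → Coprime a b → ρ ≤ σ → σ < a → (ρ * b) % a ≡ (σ * b) % a → ρ ≡ σ
    %-cancel-≤ {b} {ρ} {σ} cop ρ≤σ σ<a eq with %-≡∧≤⇒shift eq (*-monoˡ-≤ b ρ≤σ)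
    ... | x , σb≡ρb+xa = ≤-antisym ρ≤σ (m∸n≡0⇒m≤n (n≮∣ (coprime-divisor cop (divides x
        (+-cancelˡ-≡ (ρ * b) _ _ (begin-equality
          ρ * b + b * (σ ∸ ρ)   ≡⟨ regroup (σ ∸ ρ) ⟩
          (ρ + (σ ∸ ρ)) * b     ≡⟨ cong (_* b) (m+[n∸m]≡n ρ≤σ) ⟩
          σ * b                 ≡⟨ σb≡ρb+xa ⟩
          ρ * b + x * a         ∎))))))
      where
      open ≤-Reasoning
      regroup : ∀ x → ρ * b + b * x ≡ (ρ + x) * b
      regroup x = trans (cong (ρ * b +_) (*-comm b x)) (sym (*-distribʳ-+ b ρ x))
      n≮∣ : a ∣ σ ∸ ρ → σ ∸ ρ ≡ 0
      n≮∣ a∣ with σ ∸ ρ in eq′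
      ... | zero = refl
      ... | suc _ = contradiction (∣⇒≤ a∣) (<⇒≱ (≤-<-trans (≤-trans (≤-reflexive (sym eq′)) (m∸n≤m σ ρ)) σ<a))

    %-cancel : ∀ {b ρ σ} → Coprime a b → ρ < a → σ < a → (ρ * b) % a ≡ (σ * b) % a → ρ ≡ σ
    %-cancel {ρ = ρ} {σ} cop ρ<a σ<a eq with ≤-total ρ σ
    ... | inj₁ ρ≤σ = %-cancel-≤ cop ρ≤σ σ<a eq
    ... | inj₂ σ≤ρ = sym (%-cancel-≤ cop σ≤ρ ρ<a (sym eq))

  -- A certificate format for inequalities without subtraction: `l ≤ r` is a combination of known
  -- inequalities, and the ring solver checks the remaining identity.
  ≤-shift : ∀ {x y l r} → l ≤ r → x + r ≡ y + l → x ≤ y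
  ≤-shift {x} {y} {l} {r} l≤r eq =
    +-cancelʳ-≤ r x y (≤-trans (≤-reflexive eq) (+-monoʳ-≤ y l≤r))

  ≡-shift : ∀ {x y l r : ℕ} → l ≡ r → x + r ≡ y + l → x ≡ y
  ≡-shift {x} {y} {l} refl eq = +-cancelʳ-≡ l x y eq

  -- Finite sums over an initial segment

  ∑< : ℕ → (ℕ → ℕ) → ℕ
  ∑< n f = sum {n} (f ∘ toℕ)

  ∑<-cong : ∀ n {f f′} → (∀ i → i < n → f i ≡ f′ i) → ∑< n f ≡ ∑< n f′
  ∑<-cong n eq = sum-cong-≗ λ i → eq (toℕ i) (toℕ<n i)

  ∑<-+ : ∀ n f f′ → ∑< n (λ i → f i + f′ i) ≡ ∑< n f + ∑< n f′
  ∑<-+ n f f′ = ∑-distrib-+ {n} (f ∘ toℕ) (f′ ∘ toℕ)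

  ∑<-*ʳ : ∀ n f x → ∑< n (λ i → f i * x) ≡ ∑< n f * x
  ∑<-*ʳ n f x = sym (*-distribʳ-sum {n} x (f ∘ toℕ))

  ∑<-split : ∀ m n f → ∑< (m + n) f ≡ ∑< m f + ∑< n (f ∘ (m +_))
  ∑<-split zero    n f = refl
  ∑<-split (suc m) n f = trans (cong (f 0 +_) (∑<-split m n (f ∘ suc))) (sym (+-assoc (f 0) _ _))

  ∑<-const : ∀ n x → ∑< n (λ _ → x) ≡ n * x
  ∑<-const zero    x = refl
  ∑<-const (suc n) x = cong (x +_) (∑<-const n x)

  ∑<-id : ∀ n → 2 * ∑< n id + n ≡ n * n
  ∑<-id zero    = refl
  ∑<-id (suc n) = trans
    (cong (λ s → 2 * s + suc n) (trans (∑<-+ n (λ _ → 1) id) (cong (_+ ∑< n id) (∑<-const n 1))))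
    (trans (unfold n (∑< n id)) (trans (cong (λ s → s + n + n + 1) (∑<-id n)) (square n)))
    where
    unfold : ∀ n s → 2 * (n * 1 + s) + suc n ≡ 2 * s + n + n + n + 1
    unfold = solve 2 (λ n s → con 2 :* (n :* con 1 :+ s) :+ (con 1 :+ n) := con 2 :* s :+ n :+ n :+ n :+ con 1) refl
    square : ∀ n → n * n + n + n + 1 ≡ suc n * suc n
    square = solve 1 (λ n → n :* n :+ n :+ n :+ con 1 := (con 1 :+ n) :* (con 1 :+ n)) refl

  -- Representations as lattice points

  module Representations (a b c q g : ℕ) .{{_ : NonZero a}} (0<b : 0 < b) (0<c : 0 < c)
    (coprime : Coprime a b) (c+ga≡qb : c + g * a ≡ q * b) where

    generators : Vec ℕ 3
    generators = a ∷ b ∷ c ∷ []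

    ·-expand : ∀ x y z → generators · (x ∷ y ∷ z ∷ []) ≡ b * y + c * z + x * a
    ·-expand = solve 6 (λ a b c x y z → a :* x :+ (b :* y :+ (c :* z :+ con 0))
        := b :* y :+ c :* z :+ x :* a) refl a b c

    -- This says that the coefficient `y = ρ + t a - z q` is nonnegative. A record lets unification
    -- recover `ρ` and `p` from the type; the same holds for `_≼_`.
    record Valid (ρ : ℕ) (p : ℕ × ℕ) : Set where
      constructor fits
      field fit : proj₂ p * q ≤ ρ + proj₁ p * a

    -- (t , z) has weight t b - z g; both subtracted terms are moved across.
    infix 4 _≼_
    record _≼_ (p p′ : ℕ × ℕ) : Set where
      constructor lighter
      field weights : proj₁ p * b + proj₂ p′ * g ≤ proj₁ p′ * b + proj₂ p * g

    -- The coefficient y; the subtraction is exact only for valid points.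
    second : ℕ → ℕ × ℕ → ℕ
    second ρ (t , z) = ρ + t * a ∸ z * q

    -- For a valid point this is the least number that it represents, reached at `x = 0`.
    value : ℕ → ℕ × ℕ → ℕ
    value ρ (t , z) = b * second ρ (t , z) + c * z

    second-row : ∀ {ρ} p → Valid ρ p → second ρ p + proj₂ p * q ≡ ρ + proj₁ p * a
    second-row _ (fits fit) = m∸n+n≡m fit

    -- Modulo `a`, one `c` is worth `q` copies of `b`; the identity `c + g a = q b` is applied `z`
    -- times.
    combine : ∀ y z → b * y + c * z + z * g * a ≡ (y + z * q) * b
    combine y z = trans (lhs a b c g y z) (trans (cong (λ s → b * y + z * s) c+ga≡qb) (rhs b q y z))
      where
      lhs : ∀ a b c g y z → b * y + c * z + z * g * a ≡ b * y + z * (c + g * a)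
      lhs = solve 6 (λ a b c g y z → b :* y :+ c :* z :+ z :* g :* a := b :* y :+ z :* (c :+ g :* a)) refl
      rhs : ∀ b q y z → b * y + z * (q * b) ≡ (y + z * q) * b
      rhs = solve 4 (λ b q y z → b :* y :+ z :* (q :* b) := (y :+ z :* q) :* b) refl

    value-eq : ∀ {ρ} p → Valid ρ p → value ρ p + proj₂ p * g * a ≡ ρ * b + proj₁ p * b * a
    value-eq {ρ} p@(t , z) valid = trans (combine (second ρ p) z)
      (trans (cong (_* b) (second-row p valid)) (expand a b ρ t))
      where
      expand : ∀ a b ρ t → (ρ + t * a) * b ≡ ρ * b + t * b * a
      expand = solve 4 (λ a b ρ t → (ρ :+ t :* a) :* b := ρ :* b :+ t :* b :* a) refl

    value-% : ∀ {ρ} p → Valid ρ p → value ρ p % a ≡ (ρ * b) % a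
    value-% {ρ} p@(t , z) valid = trans (sym ([m+kn]%n≡m%n (value ρ p) (z * g) a))
      (trans (cong (_% a) (value-eq p valid)) ([m+kn]%n≡m%n (ρ * b) (t * b) a))

    value-mono : ∀ {ρ} p p′ → Valid ρ p → Valid ρ p′ → p ≼ p′ → value ρ p ≤ value ρ p′
    value-mono {ρ} p@(t , z) p′@(t′ , z′) valid valid′ (lighter weights) = ≤-shift
      (+-mono-≤ (+-mono-≤ (≤-reflexive (value-eq p valid))
          (≤-reflexive (sym (value-eq p′ valid′)))) (*-monoˡ-≤ a weights))
      (rearrange (value ρ p) (value ρ p′) (ρ * b) a (t * b) (t′ * b) (z * g) (z′ * g))
      where
      rearrange : ∀ v v′ r a u u′ w w′ → v + ((r + u * a + (v′ + w′ * a)) + (u′ + w) * a)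
        ≡ v′ + ((v + w * a + (r + u′ * a)) + (u + w′) * a)
      rearrange = solve 8 (λ v v′ r a u u′ w w′ → v :+ ((r :+ u :* a :+ (v′ :+ w′ :* a)) :+ (u′ :+ w) :* a)
        := v′ :+ ((v :+ w :* a :+ (r :+ u′ :* a)) :+ (u :+ w′) :* a)) refl

    -- The first entry is the true `x` only if `value ρ p ≤ n` and the two agree modulo `a`; then
    -- subtraction and division are exact.
    toVec : ℕ → ℕ → ℕ × ℕ → Vec ℕ 3
    toVec ρ n p = (n ∸ value ρ p) / a ∷ second ρ p ∷ proj₂ p ∷ []

    toVec-injective : ∀ {ρ} n {p p′} → Valid ρ p → Valid ρ p′ → toVec ρ n p ≡ toVec ρ n p′ → p ≡ p′
    toVec-injective {ρ} n {p@(t , z)} {p′@(t′ , z′)} valid valid′ eq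
      with ys , zs ← ∷-injective (proj₂ (∷-injective eq))
      with refl , _ ← ∷-injective zs =
        cong (_, z) (*-cancelʳ-≡ t t′ a (+-cancelˡ-≡ ρ _ _
          (trans (sym (second-row p valid)) (trans (cong (_+ z * q) ys) (second-row p′ valid′)))))

    toVec-solution : ∀ {ρ n} p → value ρ p % a ≡ n % a → value ρ p ≤ n → generators · toVec ρ n p ≡ n
    toVec-solution {ρ} {n} p@(t , z) r≡ v≤n with x , n≡v+xa ← %-≡∧≤⇒shift r≡ v≤n =
      trans (·-expand ((n ∸ value ρ p) / a) (second ρ p) z) (trans (cong (λ w → value ρ p + w * a)
        (trans (cong (λ m → (m ∸ value ρ p) / a) n≡v+xa)
          (trans (cong (_/ a) (m+n∸m≡n (value ρ p) (x * a))) (m*n/n≡m x a))))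
        (sym n≡v+xa))

    -- The point is read off from `s = y + z q`: modulo `a`, `s b ≡ n ≡ ρ b`, so cancelling `b`
    -- makes `ρ` the remainder of `s`, and `t` is its quotient.
    solution-pair : ∀ {ρ n} → ρ < a → (ρ * b) % a ≡ n % a → ∀ v → generators · v ≡ n →
      ∃[ p ] Valid ρ p × v ≡ toVec ρ n p × value ρ p ≤ n
    solution-pair {ρ} {n} ρ<a r≡ (x ∷ y ∷ z ∷ []) dot≡n = (t , z) , valid ,
        cong₂ (λ x y → x ∷ y ∷ z ∷ []) (sym x≡) (sym y≡) ,
        subst (_≤ n) (cong (λ w → b * w + c * z) (sym y≡)) (≤-trans (m≤m+n _ _) (≤-reflexive n≡))
      where
      s t : ℕ
      s = y + z * q
      t = s / a
      n≡ : b * y + c * z + x * a ≡ n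
      n≡ = trans (sym (·-expand x y z)) dot≡n
      sb≡ : n + z * g * a ≡ s * b + x * a
      sb≡ = trans (cong (_+ z * g * a) (sym n≡)) (trans (+-comm-middle (b * y + c * z) (x * a) (z * g * a))
        (cong (_+ x * a) (combine y z)))
        where
        +-comm-middle : ∀ k l m → k + l + m ≡ k + m + l
        +-comm-middle = solve 3 (λ k l m → k :+ l :+ m := k :+ m :+ l) refl
      s%≡ρ : s % a ≡ ρ
      s%≡ρ = %-cancel coprime (m%n<n s a) ρ<a (trans
        (trans (sym ([m+kn]%n≡m%n ((s % a) * b) (t * b) a))
          (cong (_% a) (trans (distrib (s % a) t a b) (cong (_* b) (sym (m≡m%n+[m/n]*n s a))))))
        (trans (sym ([m+kn]%n≡m%n (s * b) x a)) (trans (cong (_% a) (sym sb≡))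
          (trans ([m+kn]%n≡m%n n (z * g) a) (sym r≡)))))
        where
        distrib : ∀ u t a b → u * b + t * b * a ≡ (u + t * a) * b
        distrib = solve 4 (λ u t a b → u :* b :+ t :* b :* a := (u :+ t :* a) :* b) refl
      row : y + z * q ≡ ρ + t * a
      row = trans (m≡m%n+[m/n]*n (y + z * q) a) (cong (_+ t * a) s%≡ρ)
      valid : Valid ρ (t , z)
      valid = fits (≤-trans (m≤n+m (z * q) y) (≤-reflexive row))
      y≡ : second ρ (t , z) ≡ y
      y≡ = trans (cong (_∸ z * q) (sym row)) (m+n∸n≡m y (z * q))
      x≡ : (n ∸ value ρ (t , z)) / a ≡ x
      x≡ = trans (cong₂ (λ m w → (m ∸ (b * w + c * z)) / a) (sym n≡) y≡)
        (trans (cong (_/ a) (m+n∸m≡n (b * y + c * z) (x * a))) (m*n/n≡m x a))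

    -- A certificate, not a computation: ties are allowed, so `p` need not be unique, but its weight
    -- is. In `below` the point itself is included so that the four points can be treated as one
    -- list.
    record IsFourth (ρ : ℕ) (p : ℕ × ℕ) : Set where
      constructor isFourth
      field
        smaller : List (ℕ × ℕ)
        three   : length smaller ≡ 3
        unique  : Unique (p ∷ smaller)
        valid   : All (Valid ρ) (p ∷ smaller)
        below   : All (_≼ p) (p ∷ smaller)
        rest    : ∀ p′ → Valid ρ p′ → p′ ∈ smaller ⊎ p ≼ p′

    positive : VecAll.All (0 <_) generators
    positive = >-nonZero⁻¹ a VecAll.∷ 0<b VecAll.∷ 0<c VecAll.∷ VecAll.[]

    -- If `n` reaches the value of `p`, the four listed points give four distinct solutions. If it
    -- does not, every solution comes from a point of smaller value than `p`, hence from one of the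
    -- three in `smaller`.
    d-threshold : ∀ {ρ p n} → ρ < a → IsFourth ρ p → (ρ * b) % a ≡ n % a →
      d n generators ≤ 3 ⇔ n / a < value ρ p / a
    d-threshold {ρ} {p} {n} ρ<a (isFourth ps three unique valid below rest) r≡ = mk⇔ few⇒small small⇒few
      where
      value≡n : ∀ p → Valid ρ p → value ρ p % a ≡ n % a
      value≡n p v = trans (value-% p v) r≡
      valid-p : Valid ρ p
      valid-p = All.head valid
      few⇒small : d n generators ≤ 3 → n / a < value ρ p / a
      few⇒small d≤3 = ≰⇒> λ large → <⇒≱ (s≤s d≤3) (subst (λ l → suc l ≤ d n generators) three
        (injection-length {xs = p ∷ ps} (toVec ρ n) unique
          (λ {p′} p′∈ → Equivalence.from (∈-solutions generators n positive (toVec ρ n p′))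
            (toVec-solution p′ (value≡n p′ (All.lookup valid p′∈))
              (≤-trans (value-mono p′ p (All.lookup valid p′∈) valid-p (All.lookup below p′∈))
                (%-≡∧/-≤⇒≤ (value≡n p valid-p) large))))
          (λ {x} {y} x∈ y∈ → toVec-injective n {x} {y} (All.lookup valid x∈) (All.lookup valid y∈))))
      small⇒few : n / a < value ρ p / a → d n generators ≤ 3
      small⇒few small = ≤-trans
        (injection-length id (solutions-unique generators n) listed (λ _ _ eq → eq))
        (≤-reflexive (trans (length-map (toVec ρ n) ps) three))
        where
        listed : ∀ {v} → v ∈ solutions generators n → v ∈ map (toVec ρ n) ps
        listed {v} v∈ with p′ , valid′ , refl , value≤n ←
            solution-pair ρ<a r≡ v (Equivalence.to (∈-solutions generators n positive v) v∈)
          with rest p′ valid′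
        ... | inj₁ p′∈ = ∈-map⁺ (toVec ρ n) p′∈
        ... | inj₂ p≼p′ = contradiction (≤-trans (value-mono p p′ valid-p valid′ p≼p′) value≤n)
          (<⇒≱ (/-<⇒< small))

    multiply : Fin a → Fin a
    multiply ρ = (toℕ ρ * b) mod a

    multiply-injective : Injective _≡_ _≡_ multiply
    multiply-injective {ρ} {σ} eq = toℕ-injective (%-cancel coprime (toℕ<n ρ) (toℕ<n σ)
      (trans (sym (toℕ-mod _ a)) (trans (cong toℕ eq) (toℕ-mod _ a))))

    -- Its inverse finds, for a residue `r`, the `ρ` with `ρ b ≡ r`.
    π : Permutation a a
    π = injective⇒permutation multiply multiply-injective

    -- The classical sum `(a - 1) (b - 1) / 2`. The remainders of `ρ b` permute `0 , ... , a - 1`,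
    -- so summing `ρ b = remainder + floor * a` gives `R b = R + Q a` with `2 R + a = a a`.
    ∑-floors : 2 * ∑< a (λ ρ → ρ * b / a) + a + b ≡ a * b + 1
    ∑-floors = *-cancelʳ-≡ _ _ a (+-cancelʳ-≡ (2 * R) _ _ (begin-equality
      (2 * Q + a + b) * a + 2 * R          ≡⟨ collect a b Q R ⟩
      2 * (R + Q * a) + a * a + a * b      ≡⟨ cong₂ (λ s t → 2 * s + t + a * b) (sym Rb) (sym (∑<-id a)) ⟩
      2 * (R * b) + (2 * R + a) + a * b    ≡⟨ factor a b R ⟩
      (2 * R + a) * b + a + 2 * R          ≡⟨ cong (λ s → s * b + a + 2 * R) (∑<-id a) ⟩
      a * a * b + a + 2 * R                ≡⟨ expand a b R ⟩
      (a * b + 1) * a + 2 * R              ∎))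
      where
      open ≤-Reasoning
      R Q : ℕ
      R = ∑< a id
      Q = ∑< a (λ ρ → ρ * b / a)
      residues : ∑< a (λ ρ → (ρ * b) % a) ≡ R
      residues = trans (sum-cong-≗ {a} (λ ρ → sym (toℕ-mod (toℕ ρ * b) a))) (sym (sum-permute {a} toℕ π))
      Rb : R * b ≡ R + Q * a
      Rb = trans (sym (∑<-*ʳ a id b)) (trans (∑<-cong a (λ ρ _ → m≡m%n+[m/n]*n (ρ * b) a))
        (trans (∑<-+ a (λ ρ → (ρ * b) % a) (λ ρ → ρ * b / a * a))
          (cong₂ _+_ residues (∑<-*ʳ a (λ ρ → ρ * b / a) a))))
      collect : ∀ a b Q R → (2 * Q + a + b) * a + 2 * R ≡ 2 * (R + Q * a) + a * a + a * b
      collect = solve 4 (λ a b Q R → (con 2 :* Q :+ a :+ b) :* a :+ con 2 :* R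
        := con 2 :* (R :+ Q :* a) :+ a :* a :+ a :* b) refl
      factor : ∀ a b R → 2 * (R * b) + (2 * R + a) + a * b ≡ (2 * R + a) * b + a + 2 * R
      factor = solve 3 (λ a b R → con 2 :* (R :* b) :+ (con 2 :* R :+ a) :+ a :* b
        := (con 2 :* R :+ a) :* b :+ a :+ con 2 :* R) refl
      expand : ∀ a b R → a * a * b + a + 2 * R ≡ (a * b + 1) * a + 2 * R
      expand = solve 3 (λ a b R → a :* a :* b :+ a :+ con 2 :* R := (a :* b :+ con 1) :* a :+ con 2 :* R) refl

    sylvester-number : (T Z : ℕ → ℕ) → (∀ ρ → ρ < a → IsFourth ρ (T ρ , Z ρ)) →
      Σ[ N ∈ ℕ ] IsSylvesterNumber 3 generators N ×
        2 * N + 2 * (∑< a Z * g) + a + b ≡ a * b + 1 + 2 * (∑< a T * b)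
    sylvester-number T Z fourth = sum k , count-by-residue a (λ n → d n generators) 3 k
        (λ n → d-threshold (toℕ<n (π⁻¹ n)) (fourth _ (toℕ<n (π⁻¹ n))) (residue n)) , total
      where
      open ≤-Reasoning
      h : ℕ → ℕ
      h ρ = value ρ (T ρ , Z ρ) / a
      k : Fin a → ℕ
      k r = h (toℕ (π ⟨$⟩ˡ r))
      π⁻¹ : ℕ → Fin a
      π⁻¹ n = π ⟨$⟩ˡ (n mod a)
      residue : ∀ n → (toℕ (π⁻¹ n) * b) % a ≡ n % a
      residue n = trans (sym (toℕ-mod _ a)) (trans (cong toℕ (inverseʳ π)) (toℕ-mod n a))
      sum-k : sum k ≡ ∑< a h
      sum-k = sym (sum-permute {a} (h ∘ toℕ) (flip π))
      -- The two sides of `value-eq` have the same remainder modulo `a`; removing it and dividing by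
      -- `a` leaves an equation of quotients.
      pointwise : ∀ ρ → ρ < a → h ρ + Z ρ * g ≡ ρ * b / a + T ρ * b
      pointwise ρ ρ<a = *-cancelʳ-≡ _ _ a (+-cancelˡ-≡ ((ρ * b) % a) _ _ (begin-equality
        (ρ * b) % a + (h ρ + Z ρ * g) * a          ≡⟨ split ((ρ * b) % a) (h ρ) (Z ρ * g) ⟩
        (ρ * b) % a + h ρ * a + Z ρ * g * a        ≡⟨ cong (λ r → r + h ρ * a + Z ρ * g * a) (sym (value-% p valid)) ⟩
        value ρ p % a + h ρ * a + Z ρ * g * a      ≡⟨ cong (_+ Z ρ * g * a) (sym (m≡m%n+[m/n]*n (value ρ p) a)) ⟩
        value ρ p + Z ρ * g * a                    ≡⟨ value-eq p valid ⟩
        ρ * b + T ρ * b * a                        ≡⟨ cong (_+ T ρ * b * a) (m≡m%n+[m/n]*n (ρ * b) a) ⟩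
        (ρ * b) % a + ρ * b / a * a + T ρ * b * a  ≡⟨ sym (split ((ρ * b) % a) (ρ * b / a) (T ρ * b)) ⟩
        (ρ * b) % a + (ρ * b / a + T ρ * b) * a    ∎))
        where
        p = T ρ , Z ρ
        valid = All.head (IsFourth.valid (fourth ρ ρ<a))
        split : ∀ r u v → r + (u + v) * a ≡ r + u * a + v * a
        split r u v = trans (cong (r +_) (*-distribʳ-+ a u v)) (sym (+-assoc r _ _))
      summed : sum k + ∑< a Z * g ≡ ∑< a (λ ρ → ρ * b / a) + ∑< a T * b
      summed = begin-equality
        sum k + ∑< a Z * g                                ≡⟨ cong₂ _+_ sum-k (sym (∑<-*ʳ a Z g)) ⟩
        ∑< a h + ∑< a (λ ρ → Z ρ * g)                     ≡⟨ sym (∑<-+ a h (λ ρ → Z ρ * g)) ⟩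
        ∑< a (λ ρ → h ρ + Z ρ * g)                        ≡⟨ ∑<-cong a pointwise ⟩
        ∑< a (λ ρ → ρ * b / a + T ρ * b)                  ≡⟨ ∑<-+ a (λ ρ → ρ * b / a) (λ ρ → T ρ * b) ⟩
        ∑< a (λ ρ → ρ * b / a) + ∑< a (λ ρ → T ρ * b)     ≡⟨ cong (∑< a (λ ρ → ρ * b / a) +_) (∑<-*ʳ a T b) ⟩
        ∑< a (λ ρ → ρ * b / a) + ∑< a T * b               ∎
      double : ∀ N u Q v a b → 2 * N + 2 * u + a + b + 2 * (Q + v) ≡ 2 * Q + a + b + 2 * v + 2 * (N + u)
      double = solve 6 (λ N u Q v a b → con 2 :* N :+ con 2 :* u :+ a :+ b :+ con 2 :* (Q :+ v)
        := con 2 :* Q :+ a :+ b :+ con 2 :* v :+ con 2 :* (N :+ u)) refl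
      total : 2 * sum k + 2 * (∑< a Z * g) + a + b ≡ a * b + 1 + 2 * (∑< a T * b)
      total = +-cancelʳ-≡ (2 * (sum k + ∑< a Z * g)) _ _
        (trans (cong (λ s → 2 * sum k + 2 * (∑< a Z * g) + a + b + 2 * s) summed)
          (trans (double (sum k) (∑< a Z * g) (∑< a (λ ρ → ρ * b / a)) (∑< a T * b) a b)
            (cong (λ s → s + 2 * (∑< a T * b) + 2 * (sum k + ∑< a Z * g)) ∑-floors)))

  -- The fourth lightest point

  ≤-suc-split : ∀ {m n} → m ≤ suc n → m ≤ n ⊎ m ≡ suc n
  ≤-suc-split m≤ with m≤n⇒m<n∨m≡n m≤
  ... | inj₁ m< = inj₁ (s≤s⁻¹ m<)
  ... | inj₂ m≡ = inj₂ m≡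

  module Rows (a b c q g : ℕ) .{{_ : NonZero a}} .{{_ : NonZero q}} (0<b : 0 < b) (0<c : 0 < c)
    (coprime : Coprime a b) (c+ga≡qb : c + g * a ≡ q * b) where
    open Representations a b c q g 0<b 0<c coprime c+ga≡qb

    -- `Z` is `⌊(ρ + t a) / q⌋`, so the row holds the `Z + 1` points `z = 0 , ... , Z`. Stating it
    -- by bounds admits rows whose length is known without computing a quotient.
    record Row (ρ t Z : ℕ) : Set where
      constructor between
      field
        lower : Z * q ≤ ρ + t * a
        upper : ρ + t * a < suc Z * q

    ≼-refl : ∀ {p} → p ≼ p
    ≼-refl = lighter ≤-refl

    row : ∀ ρ t → Row ρ t ((ρ + t * a) / q)
    row ρ t = between (m/n*n≤m (ρ + t * a) q) (begin-strict
      s                       ≡⟨ m≡m%n+[m/n]*n s q ⟩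
      s % q + s / q * q    <⟨ +-monoˡ-< (s / q * q) (m%n<n s q) ⟩
      q + s / q * q           ∎)
      where
      open ≤-Reasoning
      s = ρ + t * a

    row-valid : ∀ {ρ t Z z} → Row ρ t Z → z ≤ Z → Valid ρ (t , z)
    row-valid (between Zq≤ _) z≤Z = fits (≤-trans (*-monoˡ-≤ q z≤Z) Zq≤)

    row-bound : ∀ {ρ t Z z} → Row ρ t Z → Valid ρ (t , z) → z ≤ Z
    row-bound {z = z} (between _ <Z) (fits fit) = s≤s⁻¹ (*-cancelʳ-< q z _ (≤-<-trans fit <Z))

    same-row : ∀ t {z z′} → z′ ≤ z → (t , z) ≼ (t , z′)
    same-row t z′≤z = lighter (+-monoʳ-≤ (t * b) (*-monoˡ-≤ g z′≤z))

    fourth-far : 4 * a ≤ q → 4 * (g * a) ≤ c → ∀ {ρ} → ρ < a → IsFourth ρ (3 , 0)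
    fourth-far 4a≤q 4ga≤c {ρ} ρ<a = isFourth ((0 , 0) ∷ (1 , 0) ∷ (2 , 0) ∷ []) refl
      (((λ ()) ∷ (λ ()) ∷ (λ ()) ∷ []) ∷ ((λ ()) ∷ (λ ()) ∷ []) ∷ ((λ ()) ∷ []) ∷ [] ∷ [])
      (fits z≤n ∷ fits z≤n ∷ fits z≤n ∷ fits z≤n ∷ [])
      (≼-refl ∷ step z≤n ∷ step (s≤s z≤n) ∷ step (s≤s (s≤s z≤n)) ∷ [])
      rest
      where
      step : ∀ {t} → t ≤ 3 → (t , 0) ≼ (3 , 0)
      step t≤3 = lighter (+-monoˡ-≤ 0 (*-monoˡ-≤ b t≤3))
      -- For `t ≤ 3`, `ρ + t a < 4 a ≤ q` leaves no room for `z = 1`.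
      column-zero : ∀ {t z} → t ≤ 3 → Valid ρ (t , z) → z ≡ 0
      column-zero {t} {zero}  t≤3 valid = refl
      column-zero {t} {suc z} t≤3 (fits fit) = contradiction
        (≤-trans (≤-trans 4a≤q (m≤m+n q (z * q))) fit)
        (<⇒≱ (+-mono-<-≤ ρ<a (*-monoˡ-≤ a t≤3)))
      rest : ∀ p → Valid ρ p → p ∈ ((0 , 0) ∷ (1 , 0) ∷ (2 , 0) ∷ []) ⊎ (3 , 0) ≼ p
      rest (0 , z) valid with refl ← column-zero {0} z≤n valid = inj₁ (here refl)
      rest (1 , z) valid with refl ← column-zero {1} (s≤s z≤n) valid = inj₁ (there (here refl))
      rest (2 , z) valid with refl ← column-zero {2} (s≤s (s≤s z≤n)) valid = inj₁ (there (there (here refl)))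
      rest (3 , z) valid with refl ← column-zero {3} ≤-refl valid = inj₂ ≼-refl
      -- After multiplication by `q` the claim is `z q g ≤ (1 + s) q b`. The left side is at most
      -- `(5 + s) g a`, and the right side is `(1 + s) (c + g a)`, which is large enough because
      -- `4 g a ≤ c`.
      rest (suc (suc (suc (suc s))) , z) (fits fit) = inj₂ (lighter (*-cancelʳ-≤ _ _ q (≤-shift
        (+-mono-≤ (+-mono-≤ (*-monoˡ-≤ g (≤-trans fit (+-monoˡ-≤ _ (<⇒≤ ρ<a)))) (*-monoʳ-≤ (suc s) 4ga≤c))
          (≤-trans (≤-reflexive (cong (suc s *_) c+ga≡qb)) (m≤m+n _ (4 * s * (g * a)))))
        (certificate a b c q g s z))))
        where
        certificate : ∀ a b c q g s z →
          (3 * b + z * g) * q + ((a + (4 + s) * a) * g + suc s * c + (suc s * (q * b) + 4 * s * (g * a)))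
          ≡ ((4 + s) * b + 0) * q + (z * q * g + suc s * (4 * (g * a)) + suc s * (c + g * a))
        certificate = solve 7 (λ a b c q g s z →
          (con 3 :* b :+ z :* g) :* q :+ ((a :+ (con 4 :+ s) :* a) :* g :+ (con 1 :+ s) :* c :+ ((con 1
              :+ s) :* (q :* b) :+ con 4 :* s :* (g :* a)))
          := ((con 4 :+ s) :* b :+ con 0) :* q :+ (z :* q :* g :+ (con 1 :+ s) :* (con 4 :* (g :* a))
              :+ (con 1 :+ s) :* (c :+ g :* a))) refl

    module Separated (4qg≤c : 4 * (q * g) ≤ c) where

      -- q (t b - z g) = t c - ρ g + g (ρ + t a - z q), and for the four lightest points of
      -- a row the last term lies between 0 and 4 q g ≤ c.
      later-row : ∀ {ρ t t′ Z z z′} → t < t′ → Row ρ t Z → Z ≤ 3 + z → Valid ρ (t′ , z′) → (t , z) ≼ (t′ , z′)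
      later-row {ρ} {t} {t′} {Z} {z} {z′} t<t′ (between _ <Z) Z≤ (fits fit) = lighter (*-cancelʳ-≤ _ _ q
        (subst (λ t′ → (t * b + z′ * g) * q ≤ (t′ * b + z * g) * q) t′≡
          (≤-shift (+-mono-≤ (+-mono-≤ (*-monoˡ-≤ g fit′) (*-monoʳ-≤ (suc s) 4qg≤c))
              (+-mono-≤ (*-monoˡ-≤ g (≤-trans (<⇒≤ <Z) (*-monoˡ-≤ q (s≤s Z≤))))
                (≤-trans (≤-reflexive (cong (suc s *_) c+ga≡qb)) (m≤m+n _ (4 * s * (q * g))))))
            (certificate a b c q g ρ t s z z′))))
        where
        s = t′ ∸ suc t
        t′≡ : suc t + s ≡ t′
        t′≡ = m+[n∸m]≡n t<t′
        fit′ : z′ * q ≤ ρ + (suc t + s) * a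
        fit′ = subst (λ t′ → z′ * q ≤ ρ + t′ * a) (sym t′≡) fit
        certificate : ∀ a b c q g ρ t s z z′ →
          (t * b + z′ * g) * q + ((ρ + (suc t + s) * a) * g + suc s * c + ((4 + z) * q * g + (suc s * (q * b)
              + 4 * s * (q * g))))
          ≡ ((suc t + s) * b + z * g) * q + (z′ * q * g + suc s * (4 * (q * g)) + ((ρ + t * a) * g
              + suc s * (c + g * a)))
        certificate = solve 10 (λ a b c q g ρ t s z z′ →
          (t :* b :+ z′ :* g) :* q :+ ((ρ :+ (con 1 :+ t :+ s) :* a) :* g :+ (con 1 :+ s) :* c :+ ((con 4
              :+ z) :* q :* g :+ ((con 1 :+ s) :* (q :* b) :+ con 4 :* s :* (q :* g))))
          := ((con 1 :+ t :+ s) :* b :+ z :* g) :* q :+ (z′ :* q :* g :+ (con 1 :+ s) :* (con 4 :* (q :* g))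
              :+ ((ρ :+ t :* a) :* g :+ (con 1 :+ s) :* (c :+ g :* a)))) refl

      -- Within a row the weight drops by `g` at each step of `z`, so the count runs down from the
      -- top: `m + 3`, `m + 2`, `m + 1`, `m`.
      fourth-row₀ : ∀ {ρ m} → Row ρ 0 (3 + m) → IsFourth ρ (0 , m)
      fourth-row₀ {ρ} {m} r₀ = isFourth ((0 , 1 + m) ∷ (0 , 2 + m) ∷ (0 , 3 + m) ∷ []) refl
        (((λ ()) ∷ (λ ()) ∷ (λ ()) ∷ []) ∷ ((λ ()) ∷ (λ ()) ∷ []) ∷ ((λ ()) ∷ []) ∷ [] ∷ [])
        (row-valid r₀ (m≤n+m m 3) ∷ row-valid r₀ (m≤n+m _ 2) ∷ row-valid r₀ (m≤n+m _ 1) ∷ row-valid r₀ ≤-refl ∷ [])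
        (≼-refl ∷ same-row 0 (m≤n+m m 1) ∷ same-row 0 (m≤n+m m 2) ∷ same-row 0 (m≤n+m m 3) ∷ [])
        rest
        where
        rest : ∀ p → Valid ρ p → p ∈ ((0 , 1 + m) ∷ (0 , 2 + m) ∷ (0 , 3 + m) ∷ []) ⊎ (0 , m) ≼ p
        rest (suc t , z) valid = inj₂ (later-row (s≤s z≤n) r₀ ≤-refl valid)
        rest (0 , z) valid with ≤-suc-split (row-bound r₀ valid)
        ... | inj₂ refl = inj₁ (there (there (here refl)))
        ... | inj₁ z≤2+m with ≤-suc-split z≤2+m
        ...   | inj₂ refl = inj₁ (there (here refl))
        ...   | inj₁ z≤1+m with ≤-suc-split z≤1+m
        ...     | inj₂ refl = inj₁ (here refl)
        ...     | inj₁ z≤m = inj₂ (same-row 0 z≤m)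

      -- Row 0 supplies `Z₀ + 1 ≤ 3` points, so `2 - Z₀` points at the top of row 1 precede the
      -- fourth, which is therefore at `Z₁ - (2 - Z₀)`. The clauses are the three values of `Z₀`.
      fourth-row₁ : ∀ {ρ Z₀ Z₁ m} → Row ρ 0 Z₀ → Row ρ 1 Z₁ → Z₀ ≤ 2 → Z₀ + Z₁ ≡ 2 + m → IsFourth ρ (1 , m)
      fourth-row₁ {ρ} {0} {m = m} r₀ r₁ _ refl = isFourth ((0 , 0) ∷ (1 , 1 + m) ∷ (1 , 2 + m) ∷ []) refl
        (((λ ()) ∷ (λ ()) ∷ (λ ()) ∷ []) ∷ ((λ ()) ∷ (λ ()) ∷ []) ∷ ((λ ()) ∷ []) ∷ [] ∷ [])
        (valid-m ∷ fits z≤n ∷ row-valid r₁ (m≤n+m _ 1) ∷ row-valid r₁ ≤-refl ∷ [])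
        (≼-refl ∷ later-row ≤-refl r₀ z≤n valid-m ∷ same-row 1 (m≤n+m m 1) ∷ same-row 1 (m≤n+m m 2) ∷ [])
        rest
        where
        valid-m : Valid ρ (1 , m)
        valid-m = row-valid r₁ (m≤n+m m 2)
        rest : ∀ p → Valid ρ p → p ∈ ((0 , 0) ∷ (1 , 1 + m) ∷ (1 , 2 + m) ∷ []) ⊎ (1 , m) ≼ p
        rest (0 , z) valid with z≤n ← row-bound r₀ valid = inj₁ (here refl)
        rest (suc (suc t) , z) valid = inj₂ (later-row (s≤s (s≤s z≤n)) r₁ (m≤n+m _ 1) valid)
        rest (1 , z) valid with ≤-suc-split (row-bound r₁ valid)
        ... | inj₂ refl = inj₁ (there (there (here refl)))
        ... | inj₁ z≤1+m with ≤-suc-split z≤1+m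
        ...   | inj₂ refl = inj₁ (there (here refl))
        ...   | inj₁ z≤m = inj₂ (same-row 1 z≤m)
      fourth-row₁ {ρ} {1} {m = m} r₀ r₁ _ refl = isFourth ((0 , 0) ∷ (0 , 1) ∷ (1 , 1 + m) ∷ []) refl
        (((λ ()) ∷ (λ ()) ∷ (λ ()) ∷ []) ∷ ((λ ()) ∷ (λ ()) ∷ []) ∷ ((λ ()) ∷ []) ∷ [] ∷ [])
        (valid-m ∷ fits z≤n ∷ row-valid r₀ ≤-refl ∷ row-valid r₁ ≤-refl ∷ [])
        (≼-refl ∷ later-row ≤-refl r₀ (s≤s z≤n) valid-m ∷ later-row ≤-refl r₀ (s≤s z≤n) valid-m ∷ same-row 1
            (m≤n+m m 1) ∷ [])
        rest
        where
        valid-m : Valid ρ (1 , m)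
        valid-m = row-valid r₁ (m≤n+m m 1)
        rest : ∀ p → Valid ρ p → p ∈ ((0 , 0) ∷ (0 , 1) ∷ (1 , 1 + m) ∷ []) ⊎ (1 , m) ≼ p
        rest (0 , 0) valid = inj₁ (here refl)
        rest (0 , suc z) valid with s≤s z≤n ← row-bound r₀ valid = inj₁ (there (here refl))
        rest (suc (suc t) , z) valid = inj₂ (later-row (s≤s (s≤s z≤n)) r₁ (m≤n+m _ 2) valid)
        rest (1 , z) valid with ≤-suc-split (row-bound r₁ valid)
        ... | inj₂ refl = inj₁ (there (there (here refl)))
        ... | inj₁ z≤m = inj₂ (same-row 1 z≤m)
      fourth-row₁ {ρ} {2} {m = m} r₀ r₁ _ refl = isFourth ((0 , 0) ∷ (0 , 1) ∷ (0 , 2) ∷ []) refl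
        (((λ ()) ∷ (λ ()) ∷ (λ ()) ∷ []) ∷ ((λ ()) ∷ (λ ()) ∷ []) ∷ ((λ ()) ∷ []) ∷ [] ∷ [])
        (valid-m ∷ fits z≤n ∷ row-valid r₀ (s≤s z≤n) ∷ row-valid r₀ ≤-refl ∷ [])
        (≼-refl ∷ later-row ≤-refl r₀ (s≤s (s≤s z≤n)) valid-m ∷ later-row ≤-refl r₀ (s≤s (s≤s z≤n)) valid-m
          ∷ later-row ≤-refl r₀ (s≤s (s≤s z≤n)) valid-m ∷ [])
        rest
        where
        valid-m : Valid ρ (1 , m)
        valid-m = row-valid r₁ ≤-refl
        rest : ∀ p → Valid ρ p → p ∈ ((0 , 0) ∷ (0 , 1) ∷ (0 , 2) ∷ []) ⊎ (1 , m) ≼ p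
        rest (0 , 0) valid = inj₁ (here refl)
        rest (0 , 1) valid = inj₁ (there (here refl))
        rest (0 , suc (suc z)) valid with s≤s (s≤s z≤n) ← row-bound r₀ valid = inj₁ (there (there (here refl)))
        rest (suc (suc t) , z) valid = inj₂ (later-row (s≤s (s≤s z≤n)) r₁ (m≤n+m _ 3) valid)
        rest (1 , z) valid = inj₂ (same-row 1 (row-bound r₁ valid))
      fourth-row₁ {Z₀ = suc (suc (suc _))} _ _ (s≤s (s≤s ())) _

      -- Rows 0 and 1 supply one and two points, so the fourth is the top of row 2.
      fourth-row₂ : ∀ {ρ m} → Row ρ 0 0 → Row ρ 1 1 → Row ρ 2 m → IsFourth ρ (2 , m)
      fourth-row₂ {ρ} {m} r₀ r₁ r₂ = isFourth ((0 , 0) ∷ (1 , 0) ∷ (1 , 1) ∷ []) refl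
        (((λ ()) ∷ (λ ()) ∷ (λ ()) ∷ []) ∷ ((λ ()) ∷ (λ ()) ∷ []) ∷ ((λ ()) ∷ []) ∷ [] ∷ [])
        (valid-m ∷ fits z≤n ∷ fits z≤n ∷ row-valid r₁ ≤-refl ∷ [])
        (≼-refl ∷ later-row (s≤s z≤n) r₀ z≤n valid-m ∷ later-row ≤-refl r₁ (s≤s z≤n) valid-m
          ∷ later-row ≤-refl r₁ (s≤s z≤n) valid-m ∷ [])
        rest
        where
        valid-m : Valid ρ (2 , m)
        valid-m = row-valid r₂ ≤-refl
        rest : ∀ p → Valid ρ p → p ∈ ((0 , 0) ∷ (1 , 0) ∷ (1 , 1) ∷ []) ⊎ (2 , m) ≼ p
        rest (0 , z) valid with z≤n ← row-bound r₀ valid = inj₁ (here refl)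
        rest (1 , 0) valid = inj₁ (there (here refl))
        rest (1 , suc z) valid with s≤s z≤n ← row-bound r₁ valid = inj₁ (there (there (here refl)))
        rest (2 , z) valid = inj₂ (same-row 2 (row-bound r₂ valid))
        rest (suc (suc (suc t)) , z) valid = inj₂ (later-row (s≤s (s≤s (s≤s z≤n))) r₂ (m≤n+m _ 3) valid)

  -- The sums over all residues

  -- Recursion on the cut, rather than a comparison with it, lets a proof or a sum split at the cut
  -- by plain induction.
  splice : {A : Set} → ℕ → (ℕ → A) → (ℕ → A) → ℕ → A
  splice zero    f f′         = f′
  splice (suc m) f f′ zero    = f 0
  splice (suc m) f f′ (suc i) = splice m (f ∘ suc) f′ i

  splice-elim : {A : Set} (P : ℕ → A → Set) (m : ℕ) {n : ℕ} {f f′ : ℕ → A} →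
    (∀ i → i < m → P i (f i)) → (∀ j → j < n → P (m + j) (f′ j)) →
    ∀ i → i < m + n → P i (splice m f f′ i)
  splice-elim P zero    p p′ i       i<         = p′ i i<
  splice-elim P (suc m) p p′ zero    _          = p 0 (s≤s z≤n)
  splice-elim P (suc m) p p′ (suc i) (s≤s i<) = splice-elim (P ∘ suc) m (λ i i< → p (suc i) (s≤s i<)) p′ i i<

  ∑<-splice : {A : Set} (h : A → ℕ) (m n : ℕ) {f f′ : ℕ → A} →
    ∑< (m + n) (h ∘ splice m f f′) ≡ ∑< m (h ∘ f) + ∑< n (h ∘ f′)
  ∑<-splice h zero    n = refl
  ∑<-splice h (suc m) n {f} = trans (cong (h (f 0) +_) (∑<-splice h m n)) (sym (+-assoc (h (f 0)) _ _))

  module Floors (q : ℕ) .{{_ : NonZero q}} where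

    S : ℕ → ℕ
    S n = ∑< n (_/ q)

    S-small : ∀ {n} → n ≤ q → S n ≡ 0
    S-small {n} n≤q = trans (∑<-cong n (λ i i<n → m<n⇒m/n≡0 (<-≤-trans i<n n≤q))) (trans (∑<-const n 0) (*-zeroʳ n))

    [q+n]/q : ∀ n → (q + n) / q ≡ 1 + n / q
    [q+n]/q n = trans (+-distrib-/-∣ˡ n ∣-refl) (cong (_+ n / q) (n/n≡1 q))

    -- The first `q` floors vanish, and each later one exceeds by 1 the floor `q` places before it.
    S-shift : ∀ n → S (q + n) ≡ n + S n
    S-shift n = begin-equality
      S (q + n)                          ≡⟨ ∑<-split q n (_/ q) ⟩
      S q + ∑< n (λ j → (q + j) / q)     ≡⟨ cong₂ _+_ (S-small ≤-refl) (∑<-cong n (λ j _ → [q+n]/q j)) ⟩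
      ∑< n (λ j → 1 + j / q)             ≡⟨ ∑<-+ n (λ _ → 1) (_/ q) ⟩
      ∑< n (λ _ → 1) + S n               ≡⟨ cong (_+ S n) (trans (∑<-const n 1) (*-identityʳ n)) ⟩
      n + S n                            ∎
      where open ≤-Reasoning

    S-shift-* : ∀ m n → 2 * S (m * q + n) + m * q ≡ m * (2 * n + m * q) + 2 * S n
    S-shift-* zero    n = +-identityʳ (2 * S n)
    S-shift-* (suc m) n = begin-equality
      2 * S (suc m * q + n) + suc m * q                 ≡⟨ cong (λ n → 2 * S n + suc m * q) (+-assoc q (m * q) n) ⟩
      2 * S (q + (m * q + n)) + suc m * q               ≡⟨ cong (λ s → 2 * s + suc m * q) (S-shift (m * q + n)) ⟩
      2 * (m * q + n + S (m * q + n)) + suc m * q       ≡⟨ collect q m n (S (m * q + n)) ⟩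
      2 * (m * q + n) + q + (2 * S (m * q + n) + m * q) ≡⟨ cong (2 * (m * q + n) + q +_) (S-shift-* m n) ⟩
      2 * (m * q + n) + q + (m * (2 * n + m * q) + 2 * S n) ≡⟨ factor q m n (S n) ⟩
      suc m * (2 * n + suc m * q) + 2 * S n             ∎
      where
      open ≤-Reasoning
      collect : ∀ q m n s → 2 * (m * q + n + s) + suc m * q ≡ 2 * (m * q + n) + q + (2 * s + m * q)
      collect = solve 4 (λ q m n s → con 2 :* (m :* q :+ n :+ s) :+ (con 1 :+ m) :* q
        := con 2 :* (m :* q :+ n) :+ q :+ (con 2 :* s :+ m :* q)) refl
      factor : ∀ q m n s → 2 * (m * q + n) + q + (m * (2 * n + m * q) + 2 * s) ≡ suc m * (2 * n + suc m * q) + 2 * s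
      factor = solve 4 (λ q m n s → con 2 :* (m :* q :+ n) :+ q :+ (m :* (con 2 :* n :+ m :* q) :+ con 2 :* s)
        := (con 1 :+ m) :* (con 2 :* n :+ (con 1 :+ m) :* q) :+ con 2 :* s) refl

    -- The remainder may equal `q`: the floors of `0 , ... , e - 1` still vanish then.
    S-closed : ∀ m {n e} → n ≡ m * q + e → e ≤ q → 2 * S n + m * q ≡ m * (2 * e + m * q)
    S-closed m {e = e} refl e≤q = trans (S-shift-* m e)
      (trans (cong (λ s → m * (2 * e + m * q) + 2 * s) (S-small e≤q)) (+-identityʳ _))

    S-segment : ∀ m n → ∑< n (λ j → (m + j) / q) + S m ≡ S (m + n)
    S-segment m n = trans (+-comm _ (S m)) (sym (∑<-split m n (_/ q)))

    ≤-quotient : ∀ k {n} → k * q ≤ n → k ≤ n / q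
    ≤-quotient k {n} kq≤n = ≤-trans (≤-reflexive (sym (m*n/n≡m k q))) (/-monoˡ-≤ q kq≤n)

  -- Totals of the coordinates in each of the five cases

  module Cases (a b c q g : ℕ) .{{_ : NonZero a}} .{{_ : NonZero q}} (0<b : 0 < b) (0<c : 0 < c)
    (coprime : Coprime a b) (c+ga≡qb : c + g * a ≡ q * b) where
    open Representations a b c q g 0<b 0<c coprime c+ga≡qb
    open Rows a b c q g 0<b 0<c coprime c+ga≡qb
    open Floors q

    Equals : (ℕ → Set) → Set
    Equals E = Σ[ N ∈ ℕ ] IsSylvesterNumber 3 generators N × E N

    number-of : (P : ℕ → ℕ × ℕ) → (∀ ρ → ρ < a → IsFourth ρ (P ρ)) → ∀ τ ζ →
      ∑< a (proj₁ ∘ P) ≡ τ → ∑< a (proj₂ ∘ P) ≡ ζ →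
      Equals λ N → 2 * N + 2 * (ζ * g) + a + b ≡ a * b + 1 + 2 * (τ * b)
    number-of P fourth _ _ refl refl = sylvester-number (proj₁ ∘ P) (proj₂ ∘ P) fourth

    map-equals : ∀ {E E′ : ℕ → Set} → (∀ N → E N → E′ N) → Equals E → Equals E′
    map-equals f (N , isN , eq) = N , isN , f N eq

    number-far : 4 * a ≤ q → 4 * (g * a) ≤ c → Equals λ N → 2 * N + a + b ≡ 7 * (a * b) + 1
    number-far 4a≤q 4ga≤c = map-equals (λ N eq → trans (lhs N a b g) (trans eq (rhs a b)))
      (number-of (λ _ → 3 , 0) (λ ρ ρ<a → fourth-far 4a≤q 4ga≤c ρ<a) _ _ (∑<-const a 3) (∑<-const a 0))
      where
      lhs : ∀ N a b g → 2 * N + a + b ≡ 2 * N + 2 * (a * 0 * g) + a + b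
      lhs = solve 4 (λ N a b g → con 2 :* N :+ a :+ b := con 2 :* N :+ con 2 :* (a :* con 0 :* g) :+ a :+ b) refl
      rhs : ∀ a b → a * b + 1 + 2 * (a * 3 * b) ≡ 7 * (a * b) + 1
      rhs = solve 2 (λ a b → a :* b :+ con 1 :+ con 2 :* (a :* con 3 :* b) := con 7 :* (a :* b) :+ con 1) refl

    module _ (4qg≤c : 4 * (q * g) ≤ c) where
      open Separated 4qg≤c

      row₀ : ∀ ρ → Row ρ 0 (ρ / q)
      row₀ ρ = subst (λ s → Row ρ 0 (s / q)) (+-identityʳ ρ) (row ρ 0)

      row₁ : ∀ ρ → Row ρ 1 ((a + ρ) / q)
      row₁ ρ = subst (λ s → Row ρ 1 (s / q)) (trans (cong (ρ +_) (*-identityˡ a)) (+-comm ρ a)) (row ρ 1)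

      -- The coordinate `Z₀ + Z₁ - 2` of `fourth-row₁`; the truncation is harmless once the two
      -- lengths sum to at least 2.
      ζ : ℕ → ℕ
      ζ ρ = ρ / q + (a + ρ) / q ∸ 2

      fourth-ζ : ∀ ρ → ρ < 3 * q → 2 ≤ ρ / q + (a + ρ) / q → IsFourth ρ (1 , ζ ρ)
      fourth-ζ ρ ρ<3q 2≤ = fourth-row₁ (row₀ ρ) (row₁ ρ) (s≤s⁻¹ (m<n*o⇒m/o<n ρ<3q)) (sym (m+[n∸m]≡n 2≤))

      -- Both floors in `ζ` run over intervals, from `m` and from `a + m`, so each sum is a
      -- difference of two values of `S`.
      ∑<-ζ : ∀ m n → (∀ j → j < n → 2 ≤ (m + j) / q + (a + (m + j)) / q) →
        ∑< n (λ j → ζ (m + j)) + 2 * n + S m + S (a + m) ≡ S (m + n) + S (a + m + n)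
      ∑<-ζ m n 2≤ = begin-equality
        ∑< n (λ j → ζ (m + j)) + 2 * n + S m + S (a + m)  ≡⟨ cong (λ s → s + S m + S (a + m)) restore ⟩
        A + B + S m + S (a + m)                           ≡⟨ swap A B (S m) (S (a + m)) ⟩
        (A + S m) + (B + S (a + m))                       ≡⟨ cong₂ _+_ (S-segment m n) (S-segment (a + m) n) ⟩
        S (m + n) + S (a + m + n)                         ∎
        where
        open ≤-Reasoning
        A B : ℕ
        A = ∑< n (λ j → (m + j) / q)
        B = ∑< n (λ j → (a + m + j) / q)
        swap : ∀ k l m n → k + l + m + n ≡ (k + m) + (l + n)
        swap = solve 4 (λ k l m n → k :+ l :+ m :+ n := (k :+ m) :+ (l :+ n)) refl
        restore : ∑< n (λ j → ζ (m + j)) + 2 * n ≡ A + B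
        restore = begin-equality
          ∑< n (λ j → ζ (m + j)) + 2 * n           ≡⟨ cong (∑< n (λ j → ζ (m + j)) +_)
              (trans (*-comm 2 n) (sym (∑<-const n 2))) ⟩
          ∑< n (λ j → ζ (m + j)) + ∑< n (λ _ → 2)  ≡⟨ sym (∑<-+ n (λ j → ζ (m + j)) (λ _ → 2)) ⟩
          ∑< n (λ j → ζ (m + j) + 2)               ≡⟨ ∑<-cong n (λ j j<n → trans (m∸n+n≡m (2≤ j j<n))
                                                        (cong (λ s → (m + j) / q + s / q) (sym (+-assoc a m j)))) ⟩
          ∑< n (λ j → (m + j) / q + (a + m + j) / q) ≡⟨ ∑<-+ n (λ j → (m + j) / q) (λ j → (a + m + j) / q) ⟩
          A + B                                    ∎

      -- the case k = i
      number-equal : q ≡ a → Equals λ N → 2 * N + 4 * (a * g) + a + b ≡ 5 * (a * b) + 1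
      number-equal refl = map-equals (λ N eq → trans (lhs N a b g) (trans eq (rhs a b)))
        (number-of (λ _ → 2 , 2)
          (λ ρ ρ<a → fourth-row₂ (on-row ρ 0 ρ<a) (on-row ρ 1 ρ<a) (on-row ρ 2 ρ<a)) _ _ (∑<-const a 2) (∑<-const a 2))
        where
        -- With `q = a` the length `⌊(ρ + t a) / a⌋` is `t` for every residue, so the top of row 2
        -- is always fourth.
        on-row : ∀ ρ t → ρ < a → Row ρ t t
        on-row ρ t ρ<a = between (m≤n+m (t * a) ρ) (+-monoˡ-< (t * a) ρ<a)
        lhs : ∀ N a b g → 2 * N + 4 * (a * g) + a + b ≡ 2 * N + 2 * (a * 2 * g) + a + b
        lhs = solve 4 (λ N a b g → con 2 :* N :+ con 4 :* (a :* g) :+ a :+ b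
            := con 2 :* N :+ con 2 :* (a :* con 2 :* g) :+ a :+ b) refl
        rhs : ∀ a b → a * b + 1 + 2 * (a * 2 * b) ≡ 5 * (a * b) + 1
        rhs = solve 2 (λ a b → a :* b :+ con 1 :+ con 2 :* (a :* con 2 :* b) := con 5 :* (a :* b) :+ con 1) refl

      -- the case k = i - 1, where e = F (i - 4)
      number-minus-one : ∀ {e} → e ≤ g → q ≡ 2 * g + e → a ≡ 3 * g + 2 * e →
        Equals λ N → 2 * N + 4 * (q * g) + a + b ≡ a * b + 1 + 4 * (q * b)
      number-minus-one {e} e≤g q≡ a≡ = map-equals (λ N eq → trans (lhs N a b q g) (trans eq (rhs a b q)))
        (number-of P fourth (2 * q) (2 * q) total-τ total-ζ)
        where
        open ≤-Reasoning
        -- `u` is `F (i - 2)`, so that `a = q + u`, and `n = a - g` counts the residues from `g` on.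
        u n : ℕ
        u = g + e
        n = 2 * u
        a≡g+n : a ≡ g + n
        a≡g+n = trans a≡ (solve 2 (λ g e → con 3 :* g :+ con 2 :* e := g :+ con 2 :* (g :+ e)) refl g e)
        a≡q+u : a ≡ q + u
        a≡q+u = trans a≡ (trans (solve 2 (λ g e → con 3 :* g :+ con 2 :* e
            := con 2 :* g :+ e :+ (g :+ e)) refl g e) (cong (_+ u) (sym q≡)))
        a+g≡2q : a + g ≡ 2 * q
        a+g≡2q = trans (cong (_+ g) a≡) (trans (solve 2 (λ g e → con 3 :* g :+ con 2 :* e :+ g
            := con 2 :* (con 2 :* g :+ e)) refl g e) (cong (2 *_) (sym q≡)))
        2a≡3q+e : 2 * a ≡ 3 * q + e
        2a≡3q+e = trans (cong (2 *_) a≡) (trans (solve 2 (λ g e → con 2 :* (con 3 :* g :+ con 2 :* e)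
            := con 3 :* (con 2 :* g :+ e) :+ e) refl g e) (cong (λ q → 3 * q + e) (sym q≡)))
        u≤q : u ≤ q
        u≤q = ≤-trans (m≤m+n u g) (≤-reflexive (trans (solve 2 (λ g e → g :+ e :+ g
            := con 2 :* g :+ e) refl g e) (sym q≡)))
        g≤q : g ≤ q
        g≤q = ≤-trans (m≤m+n g e) u≤q
        e≤q : e ≤ q
        e≤q = ≤-trans e≤g g≤q
        high : ∀ j → 2 ≤ (g + j) / q + (a + (g + j)) / q
        high j = ≤-trans (≤-quotient 2 (≤-trans (≤-reflexive (sym a+g≡2q)) (+-monoʳ-≤ a (m≤m+n g j)))) (m≤n+m _ _)
        -- For `ρ < g`, `ρ + a < 2 q` stops row 1 at `z = 1`, and rows 0 and 1 hold only three
        -- points. From `ρ = g` on, row 1 reaches `z = 2` and contains the fourth.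
        P : ℕ → ℕ × ℕ
        P = splice g (λ _ → 2 , 3) (λ j → 1 , ζ (g + j))
        fourth-low : ∀ ρ → ρ < g → IsFourth ρ (2 , 3)
        fourth-low ρ ρ<g = fourth-row₂
          (between z≤n (subst₂ _<_ (sym (+-identityʳ ρ)) (sym (+-identityʳ q)) (<-≤-trans ρ<g g≤q)))
          (between (≤-trans (*-monoʳ-≤ 1 (≤-trans (m≤m+n q u) (≤-reflexive (sym a≡q+u)))) (m≤n+m (1 * a) ρ))
            (<-≤-trans (+-monoˡ-< (1 * a) ρ<g)
              (≤-reflexive (trans (trans (cong (g +_) (*-identityˡ a)) (+-comm g a)) a+g≡2q))))
          (between (≤-trans (≤-trans (m≤m+n (3 * q) e) (≤-reflexive (sym 2a≡3q+e))) (m≤n+m (2 * a) ρ))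
            (<-≤-trans (+-monoˡ-< (2 * a) ρ<g) (begin
              g + 2 * a        ≡⟨ cong (g +_) 2a≡3q+e ⟩
              g + (3 * q + e)  ≡⟨ solve 3 (λ g q e → g :+ (con 3 :* q :+ e) := g :+ e :+ con 3 :* q) refl g q e ⟩
              u + 3 * q        ≤⟨ +-monoˡ-≤ (3 * q) u≤q ⟩
              4 * q            ∎)))
        fourth-high : ∀ j → j < n → IsFourth (g + j) (1 , ζ (g + j))
        fourth-high j j<n = fourth-ζ (g + j)
          (<-≤-trans (+-monoʳ-< g j<n) (≤-trans (≤-reflexive (trans (sym a≡g+n) a≡q+u))
            (+-monoʳ-≤ q (≤-trans u≤q (m≤m+n q _)))))
          (high j)
        fourth : ∀ ρ → ρ < a → IsFourth ρ (P ρ)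
        fourth = subst (λ a → ∀ ρ → ρ < a →
            IsFourth ρ (P ρ)) (sym a≡g+n) (splice-elim IsFourth g fourth-low fourth-high)
        total-τ : ∑< a (proj₁ ∘ P) ≡ 2 * q
        total-τ = trans (cong (λ a → ∑< a (proj₁ ∘ P)) a≡g+n) (trans (∑<-splice proj₁ g n)
          (trans (cong₂ _+_ (∑<-const g 2) (∑<-const n 1))
            (trans (solve 2 (λ g e → g :* con 2 :+ con 2 :* (g :+ e) :* con 1 := con 2 :* (con 2 :* g :+ e)) refl g e)
              (cong (2 *_) (sym q≡)))))
        X : ℕ
        X = ∑< n (λ j → ζ (g + j))
        -- `S g` vanishes since `g ≤ q`, and `S (g + n) = S (q + u) = u`; only `S (2 a)` and
        -- `S (2 q)` are left for the closed form.
        segment : X + 2 * n + 0 + S (2 * q) ≡ u + S (2 * a)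
        segment = begin-equality
          X + 2 * n + 0 + S (2 * q)       ≡⟨ cong₂ (λ s t → X + 2 * n + s + S t) (sym (S-small g≤q)) (sym a+g≡2q) ⟩
          X + 2 * n + S g + S (a + g)     ≡⟨ ∑<-ζ g n (λ j _ → high j) ⟩
          S (g + n) + S (a + g + n)       ≡⟨ cong₂ (λ s t → S s + S t) (trans (sym a≡g+n) a≡q+u) a+g+n≡2a ⟩
          S (q + u) + S (2 * a)           ≡⟨ cong (_+ S (2 * a)) (trans (S-shift u) (trans
              (cong (u +_) (S-small u≤q)) (+-identityʳ u))) ⟩
          u + S (2 * a)                   ∎
          where
          a+g+n≡2a : a + g + n ≡ 2 * a
          a+g+n≡2a = trans (+-assoc a g n) (cong (a +_) (trans (sym a≡g+n) (sym (+-identityʳ a))))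
        total-ζ : ∑< a (proj₂ ∘ P) ≡ 2 * q
        total-ζ = trans (cong (λ a → ∑< a (proj₂ ∘ P)) a≡g+n) (trans (∑<-splice proj₂ g n)
          (trans (cong (_+ X) (∑<-const g 3)) (*-cancelˡ-≡ _ _ 2
            (≡-shift (cong₂ _+_ (cong (2 *_) segment)
                (cong₂ _+_ (S-closed 3 2a≡3q+e e≤q) (sym (S-closed 2 (sym (+-identityʳ (2 * q))) z≤n))))
              (balance g e q X (S (2 * q)) (S (2 * a)))))))
          where
          balance : ∀ g e q X s t → 2 * (g * 3 + X) + (2 * (g + e + t) + (3 * (2 * e + 3 * q) + (2 * s + 2 * q)))
            ≡ 2 * (2 * q) + (2 * (X + 2 * (2 * (g + e)) + 0 + s) + (2 * t + 3 * q + 2 * (2 * 0 + 2 * q)))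
          balance = solve 6 (λ g e q X s t → con 2 :* (g :* con 3 :+ X) :+ (con 2 :* (g :+ e :+ t)
              :+ (con 3 :* (con 2 :* e :+ con 3 :* q) :+ (con 2 :* s :+ con 2 :* q)))
            := con 2 :* (con 2 :* q) :+ (con 2 :* (X :+ con 2 :* (con 2 :* (g :+ e)) :+ con 0 :+ s)
                :+ (con 2 :* t :+ con 3 :* q :+ con 2 :* (con 2 :* con 0 :+ con 2 :* q)))) refl
        lhs : ∀ N a b q g → 2 * N + 4 * (q * g) + a + b ≡ 2 * N + 2 * (2 * q * g) + a + b
        lhs = solve 5 (λ N a b q g → con 2 :* N :+ con 4 :* (q :* g) :+ a :+ b
            := con 2 :* N :+ con 2 :* (con 2 :* q :* g) :+ a :+ b) refl
        rhs : ∀ a b q → a * b + 1 + 2 * (2 * q * b) ≡ a * b + 1 + 4 * (q * b)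
        rhs = solve 3 (λ a b q → a :* b :+ con 1 :+ con 2 :* (con 2 :* q :* b)
            := a :* b :+ con 1 :+ con 4 :* (q :* b)) refl

      ∑<-ζ-from-0 : ∀ n → (∀ j → j < n → 2 ≤ j / q + (a + j) / q) → ∑< n ζ + 2 * n + S a ≡ S n + S (a + n)
      ∑<-ζ-from-0 n 2≤ = trans (sym (cong₂ _+_ (+-identityʳ (∑< n ζ + 2 * n)) (cong S (+-identityʳ a))))
        (trans (∑<-ζ 0 n 2≤) (cong (λ m → S n + S (m + n)) (+-identityʳ a)))

      -- the case k = i - 2, where e = F (i - 5)
      number-minus-two : ∀ {e} → q ≡ 2 * g + e → a ≡ 5 * g + 3 * e →
        Equals λ N → 2 * N + 16 * (a * g) + a + b ≡ 3 * (a * b) + 1 + 30 * (q * g)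
      number-minus-two {e} q≡ a≡ = map-equals (λ N eq → ≡-shift (cong₂ _+_ eq
          (cong (g *_) (sym 2X))) (final N a b q g X))
        (number-of (λ ρ → 1 , ζ ρ) (λ ρ ρ<a → fourth-ζ ρ (<-≤-trans ρ<a a≤3q) (high ρ)) (a * 1) X (∑<-const a 1) refl)
        where
        X : ℕ
        X = ∑< a ζ
        e≤q : e ≤ q
        e≤q = ≤-trans (m≤n+m e (2 * g)) (≤-reflexive (sym q≡))
        a≤3q : a ≤ 3 * q
        a≤3q = ≤-trans (m≤m+n a g) (≤-reflexive (trans (cong (_+ g) a≡)
          (trans (solve 2 (λ g e → con 5 :* g :+ con 3 :* e :+ g
              := con 3 :* (con 2 :* g :+ e)) refl g e) (cong (3 *_) (sym q≡)))))
        2q≤a : 2 * q ≤ a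
        2q≤a = ≤-trans (≤-trans (m≤m+n (2 * q) (g + e)) (≤-reflexive (trans (cong (λ q → 2 * q + (g + e)) q≡)
          (solve 2 (λ g e → con 2 :* (con 2 :* g :+ e) :+ (g :+ e)
              := con 5 :* g :+ con 3 :* e) refl g e)))) (≤-reflexive (sym a≡))
        a+a≡5q+e : a + a ≡ 5 * q + e
        a+a≡5q+e = trans (cong₂ _+_ a≡ a≡)
          (trans (solve 2 (λ g e → con 5 :* g :+ con 3 :* e :+ (con 5 :* g :+ con 3 :* e)
              := con 5 :* (con 2 :* g :+ e) :+ e) refl g e)
            (cong (λ q → 5 * q + e) (sym q≡)))
        high : ∀ j → 2 ≤ j / q + (a + j) / q
        high j = ≤-trans (≤-quotient 2 (≤-trans 2q≤a (m≤m+n a j))) (m≤n+m _ _)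
        -- In the sum of `ζ` the two terms `S a` cancel, leaving `X = S (2 a) - 2 a`. With
        -- `2 a = 5 q + e`, the closed form gives `2 S (2 a) = 20 a - 30 q`.
        2X : 2 * X + 30 * q ≡ 16 * a
        2X = ≡-shift (cong₂ _+_ (cong (2 *_) (∑<-ζ-from-0 a (λ j _ → high j)))
               (cong₂ _+_ (S-closed 5 a+a≡5q+e e≤q) (cong (10 *_) (sym a+a≡5q+e))))
          (balance a q e X (S a) (S (a + a)))
          where
          balance : ∀ a q e X s t → 2 * X + 30 * q + (2 * (s + t) + (5 * (2 * e + 5 * q) + 10 * (a + a)))
            ≡ 16 * a + (2 * (X + 2 * a + s) + (2 * t + 5 * q + 10 * (5 * q + e)))
          balance = solve 6 (λ a q e X s t → con 2 :* X :+ con 30 :* q :+ (con 2 :* (s :+ t)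
              :+ (con 5 :* (con 2 :* e :+ con 5 :* q) :+ con 10 :* (a :+ a)))
            := con 16 :* a :+ (con 2 :* (X :+ con 2 :* a :+ s) :+ (con 2 :* t :+ con 5 :* q
                :+ con 10 :* (con 5 :* q :+ e)))) refl
        final : ∀ N a b q g X → 2 * N + 16 * (a * g) + a + b + (a * b + 1 + 2 * (a * 1 * b) + g * (2 * X + 30 * q))
          ≡ 3 * (a * b) + 1 + 30 * (q * g) + (2 * N + 2 * (X * g) + a + b + g * (16 * a))
        final = solve 6 (λ N a b q g X → con 2 :* N :+ con 16 :* (a :* g) :+ a :+ b :+ (a :* b :+ con 1
            :+ con 2 :* (a :* con 1 :* b) :+ g :* (con 2 :* X :+ con 30 :* q))
            := con 3 :* (a :* b) :+ con 1 :+ con 30 :* (q :* g) :+ (con 2 :* N :+ con 2 :* (X :* g) :+ a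
            :+ b :+ g :* (con 16 :* a))) refl

      -- the case k ≤ i - 3, where m = r - 3
      number-small : ∀ m {e} → e ≤ q → a ≡ (3 + m) * q + e →
        Equals λ N → 2 * N + 6 * (a * g) + 2 * (m * a * g) + a + b ≡ a * b + 1 + 6 * (q * b) + m * (7 + m) * (q * g)
      number-small m {e} e≤q a≡ = map-equals (λ N eq → ≡-shift (cong₂ _+_ eq
          (cong (g *_) (sym 2Y))) (final N a b q g m Y))
        (number-of P fourth (3 * q) Y total-τ refl)
        where
        n Y X : ℕ
        n = m * q + e
        P : ℕ → ℕ × ℕ
        P = splice (3 * q) (λ ρ → 1 , ζ ρ) (λ j → 0 , j / q)
        Y = ∑< a (proj₂ ∘ P)
        X = ∑< (3 * q) ζ
        a≡3q+n : a ≡ 3 * q + n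
        a≡3q+n = trans a≡ (solve 3 (λ m q e → (con 3 :+ m) :* q :+ e := con 3 :* q :+ (m :* q :+ e)) refl m q e)
        3q≤a : 3 * q ≤ a
        3q≤a = ≤-trans (m≤m+n (3 * q) n) (≤-reflexive (sym a≡3q+n))
        high : ∀ j → 2 ≤ j / q + (a + j) / q
        high j = ≤-trans (≤-trans (n≤1+n 2) (≤-quotient 3 (≤-trans 3q≤a (m≤m+n a j)))) (m≤n+m _ _)
        -- From `ρ = 3 q` on, row 0 alone has four points; its length is `3 + ⌊j / q⌋`.
        fourth-high : ∀ j → j < n → IsFourth (3 * q + j) (0 , j / q)
        fourth-high j _ = fourth-row₀ (subst (Row (3 * q + j) 0)
          (trans (+-distrib-/-∣ˡ j (n∣m*n 3)) (cong (_+ j / q) (m*n/n≡m 3 q))) (row₀ (3 * q + j)))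
        fourth : ∀ ρ → ρ < a → IsFourth ρ (P ρ)
        fourth = subst (λ a → ∀ ρ → ρ < a → IsFourth ρ (P ρ)) (sym a≡3q+n)
          (splice-elim IsFourth (3 * q) (λ ρ ρ< → fourth-ζ ρ ρ< (high ρ)) fourth-high)
        total-τ : ∑< a (proj₁ ∘ P) ≡ 3 * q
        total-τ = trans (cong (λ a → ∑< a (proj₁ ∘ P)) a≡3q+n) (trans (∑<-splice proj₁ (3 * q) n)
          (trans (cong₂ _+_ (∑<-const (3 * q) 1) (∑<-const n 0))
            (trans (cong₂ _+_ (*-identityʳ (3 * q)) (*-zeroʳ n)) (+-identityʳ (3 * q)))))
        Y≡ : Y ≡ X + S n
        Y≡ = trans (cong (λ a → ∑< a (proj₂ ∘ P)) a≡3q+n) (∑<-splice proj₂ (3 * q) n)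
        -- Shifting by three blocks removes `S a` against `S (a + 3 q)`, so that `X = 3 a`. The sum
        -- `S n`, with `e = a - (3 + m) q` substituted, supplies `m (7 + m) = (r - 3) (r + 4)`.
        2Y : 2 * Y + m * (7 + m) * q ≡ 6 * a + 2 * (m * a)
        2Y = ≡-shift (cong₂ _+_ (cong₂ _+_ (cong (2 *_) Y≡) (cong (2 *_) (∑<-ζ-from-0 (3 * q) (λ j _ → high j))))
               (cong₂ _+_ (cong₂ _+_ (S-closed m {n} refl e≤q) (S-closed 3 (sym (+-identityʳ (3 * q))) z≤n))
                 (cong₂ _+_ (trans (cong (λ s → 2 * S s + 3 * q) (+-comm a (3 * q))) (S-shift-* 3 a))
                     (cong (2 * m *_) (sym a≡)))))
          (balance a q e m X Y (S n) (S (3 * q)) (S a) (S (a + 3 * q)))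
          where
          balance : ∀ a q e m X Y s t v w →           2 * Y + m * (7 + m) * q + (2 * (X + s) + 2 * (t + w)
              + (m * (2 * e + m * q) + 3 * (2 * 0 + 3 * q) + (3 * (2 * a + 3 * q) + 2 * v + 2 * m * a)))
            ≡ 6 * a + 2 * (m * a) + (2 * Y + 2 * (X + 2 * (3 * q) + v) + (2 * s + m * q + (2 * t + 3 * q)
                + (2 * w + 3 * q + 2 * m * ((3 + m) * q + e))))
          balance = solve 10 (λ a q e m X Y s t v w → con 2 :* Y :+ m :* (con 7 :+ m) :* q :+ (con 2 :* (X
              :+ s) :+ con 2 :* (t :+ w) :+ (m :* (con 2 :* e :+ m :* q) :+ con 3 :* (con 2 :* con 0
              :+ con 3 :* q) :+ (con 3 :* (con 2 :* a :+ con 3 :* q) :+ con 2 :* v :+ con 2 :* m :* a)))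
              := con 6 :* a :+ con 2 :* (m :* a) :+ (con 2 :* Y :+ con 2 :* (X :+ con 2 :* (con 3 :* q)
              :+ v) :+ (con 2 :* s :+ m :* q :+ (con 2 :* t :+ con 3 :* q) :+ (con 2 :* w :+ con 3 :* q
              :+ con 2 :* m :* ((con 3 :+ m) :* q :+ e))))) refl
        final : ∀ N a b q g m Y → 2 * N + 6 * (a * g) + 2 * (m * a * g) + a + b + (a * b + 1
            + 2 * (3 * q * b) + g * (2 * Y + m * (7 + m) * q))
          ≡ a * b + 1 + 6 * (q * b) + m * (7 + m) * (q * g) + (2 * N + 2 * (Y * g) + a + b + g * (6 * a
              + 2 * (m * a)))
        final = solve 7 (λ N a b q g m Y → con 2 :* N :+ con 6 :* (a :* g) :+ con 2 :* (m :* a :* g) :+ a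
            :+ b :+ (a :* b :+ con 1 :+ con 2 :* (con 3 :* q :* b) :+ g :* (con 2 :* Y :+ m :* (con 7
            :+ m) :* q))
            := a :* b :+ con 1 :+ con 6 :* (q :* b) :+ m :* (con 7 :+ m) :* (q :* g) :+ (con 2 :* N
            :+ con 2 :* (Y :* g) :+ a :+ b :+ g :* (con 6 :* a :+ con 2 :* (m :* a)))) refl

  -- Fibonacci numbers

  fib-mono : ∀ {m n} → m ≤ n → fib m ≤ fib n
  fib-mono {n = n} z≤n = z≤n
  fib-mono {1} {suc n} (s≤s z≤n) = fib-positive n
  fib-mono {suc (suc m)} (s≤s (s≤s m≤n)) = +-mono-≤ (fib-mono (s≤s m≤n)) (fib-mono m≤n)

  fib-double : ∀ n → 2 * fib n ≤ fib (2 + n)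
  fib-double n = +-mono-≤ (fib-mono (n≤1+n n)) (≤-reflexive (+-identityʳ (fib n)))

  fib≤double : ∀ n → fib (2 + n) ≤ 2 * fib (1 + n)
  fib≤double n = +-monoʳ-≤ (fib (1 + n)) (≤-trans (fib-mono (n≤1+n n)) (m≤m+n _ 0))

  fib-coprime : ∀ n → Coprime (fib n) (fib (1 + n))
  fib-coprime zero    = Coprimality.sym (1-coprimeTo 0)
  fib-coprime (suc n) = Coprimality.sym (coprime-+ (fib-coprime n))

  fib-coprime₂ : ∀ n → Coprime (fib n) (fib (n + 2))
  fib-coprime₂ n = subst (Coprime (fib n)) (cong fib (+-comm 2 n))
    (Coprimality.sym (subst (λ x → Coprime x (fib n)) (+-comm (fib n) (fib (1
        + n))) (coprime-+ (Coprimality.sym (fib-coprime n)))))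

  -- Both sides obey the Fibonacci recurrence in `k`. This is `c + g a = q b` with the index moved
  -- up by 2, which keeps truncated subtraction out of the induction.
  fib-shift : ∀ i k → fib (i + (2 + k)) + fib k * fib i ≡ fib (2 + k) * fib (i + 2)
  fib-shift i 0 = refl
  fib-shift i 1 = subst₂ (λ x y → fib x + 1 * fib i ≡ 2 * fib y) (+-comm 3 i) (+-comm 2 i)
    (solve 2 (λ u v → u :+ v :+ u :+ con 1 :* v := con 2 :* (u :+ v)) refl (fib (1 + i)) (fib i))
  fib-shift i (suc (suc k)) = trans
    (cong (λ n → fib n + fib (2 + k) * fib i) (trans (+-comm i (4 + k)) (cong (2 +_) (+-comm (2 + k) i))))
    (trans (regroup (fib (suc (i + (2 + k)))) (fib (i + (2 + k))) (fib (1 + k)) (fib k) (fib i))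
      (trans (cong₂ _+_ (trans (cong (λ n → fib n + fib (1 + k) * fib i) (sym (+-suc i (2
          + k)))) (fib-shift i (suc k))) (fib-shift i k))
        (sym (*-distribʳ-+ (fib (i + 2)) (fib (3 + k)) (fib (2 + k))))))
    where
    regroup : ∀ x y u v w → x + y + (u + v) * w ≡ (x + u * w) + (y + v * w)
    regroup = solve 5 (λ x y u v w → x :+ y :+ (u :+ v) :* w := (x :+ u :* w) :+ (y :+ v :* w)) refl

  -- Of the two copies of `q b` in `2 c + 2 g a = 2 q b`, one covers `8 q g` and the other `2 g a`.
  separated : ∀ {a b c q g} → c + g * a ≡ q * b → 8 * g ≤ b → 2 * g ≤ q → a ≤ b → 4 * (q * g) ≤ c
  separated {a} {b} {c} {q} {g} c+ga≡qb 8g≤b 2g≤q a≤b = *-cancelˡ-≤ 2 (+-cancelʳ-≤ (2 * (g * a)) _ _ (begin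
    2 * (4 * (q * g)) + 2 * (g * a)  ≡⟨ solve 3 (λ a q g → con 2 :* (con 4 :* (q :* g)) :+ con 2 :* (g :* a)
        := q :* (con 8 :* g) :+ con 2 :* g :* a) refl a q g ⟩
    q * (8 * g) + 2 * g * a          ≤⟨ +-mono-≤ (*-monoʳ-≤ q 8g≤b) (*-mono-≤ 2g≤q a≤b) ⟩
    q * b + q * b                    ≡⟨ sym (cong₂ _+_ c+ga≡qb c+ga≡qb) ⟩
    c + g * a + (c + g * a)          ≡⟨ solve 3 (λ a c g → c :+ g :* a :+ (c :+ g :* a) := con 2 :* c
        :+ con 2 :* (g :* a)) refl a c g ⟩
    2 * c + 2 * (g * a)              ∎))
    where open ≤-Reasoning

  -- 3 F k < F (k + 3), while F (k + 2) ≤ 3 F k.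
  module _ (i k : ℕ) (3≤i : 3 ≤ i) (3≤k : 3 ≤ k) where
    private instance
      nonZero : NonZero (fib k)
      nonZero = fib-nonZero 3≤k

    quotient≥3⇔ : 3 ≤ (fib i ∸ 1) / fib k ⇔ k ≤ i ∸ 3
    quotient≥3⇔ = mk⇔ to from
      where
      to : 3 ≤ (fib i ∸ 1) / fib k → k ≤ i ∸ 3
      to 3≤r = ≮⇒≥ λ i∸3<k → <⇒≱ (below 3≤r) (above (≤-trans (≤-reflexive (sym (m+[n∸m]≡n 3≤i))) (+-monoʳ-≤ 2 i∸3<k)))
        where
        below : 3 ≤ (fib i ∸ 1) / fib k → 3 * fib k < fib i
        below 3≤r = ≤-trans (s≤s (≤-trans (*-monoˡ-≤ (fib k) 3≤r) (m/n*n≤m (fib i ∸ 1) (fib k))))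
          (≤-reflexive (m+[n∸m]≡n (fib-mono {1} (≤-trans (s≤s z≤n) 3≤i))))
        above : i ≤ 2 + k → fib i ≤ 3 * fib k
        above i≤ = ≤-trans (fib-mono i≤) (≤-trans (+-monoˡ-≤ (fib k) (fib-suc k 3≤k))
          (≤-reflexive (solve 1 (λ x → con 2 :* x :+ x := con 3 :* x) refl (fib k))))
          where
          fib-suc : ∀ k → 3 ≤ k → fib (1 + k) ≤ 2 * fib k
          fib-suc (suc k) _ = fib≤double k
      from : k ≤ i ∸ 3 → 3 ≤ (fib i ∸ 1) / fib k
      from k≤ = ≤-trans (≤-reflexive (sym (m*n/n≡m 3 (fib k)))) (/-monoˡ-≤ (fib k)
        (s≤s⁻¹ (≤-trans (above k≤) (≤-reflexive (sym (m+[n∸m]≡n (fib-mono {1} (≤-trans (s≤s z≤n) 3≤i))))))))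
        where
        triple : ∀ k → 3 ≤ k → 3 * fib k < fib (3 + k)
        triple (suc (suc k)) (s≤s (s≤s _)) = <-≤-trans (m<m+n (3 * fib (2 + k)) (fib-positive k))
          (≤-trans (m≤m+n _ (fib (1 + k))) (≤-reflexive (solve 2 (λ x y →
             con 3 :* (x :+ y) :+ x :+ x := x :+ y :+ x :+ (x :+ y) :+ (x :+ y :+ x)) refl (fib (1 + k)) (fib k))))
        above : k ≤ i ∸ 3 → 3 * fib k < fib i
        above k≤ = <-≤-trans (triple k 3≤k) (fib-mono (≤-trans (+-monoʳ-≤ 3 k≤) (≤-reflexive (m+[n∸m]≡n 3≤i))))

  0<fib : ∀ {n} → 1 ≤ n → 0 < fib n
  0<fib {suc n} _ = fib-positive n

  -- `c` is separate from `fib (i + k)` so that the third generator can keep the forms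
  -- `fib (2 * i)`, `fib (2 * i ∸ 1)` and `fib (2 * i ∸ 2)`.
  module FibCases (i k : ℕ) (3≤i : 3 ≤ i) (3≤k : 3 ≤ k) (c : ℕ) (c≡ : c ≡ fib (i + k)) where
    1≤i : 1 ≤ i
    1≤i = ≤-trans (s≤s z≤n) 3≤i

    private instance
      nonZero-a : NonZero (fib i)
      nonZero-a = >-nonZero (0<fib 1≤i)
      nonZero-q : NonZero (fib k)
      nonZero-q = fib-nonZero 3≤k

    identity : c + fib (k ∸ 2) * fib i ≡ fib k * fib (i + 2)
    identity = subst (λ n → c + fib (k ∸ 2) * fib i ≡ fib n * fib (i + 2)) 2+[k∸2]≡k
      (trans (cong (_+ fib (k ∸ 2) * fib i) (trans c≡ (cong (λ n → fib (i
          + n)) (sym 2+[k∸2]≡k)))) (fib-shift i (k ∸ 2)))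
      where
      2+[k∸2]≡k : 2 + (k ∸ 2) ≡ k
      2+[k∸2]≡k = m+[n∸m]≡n (≤-trans (n≤1+n 2) 3≤k)

    open Cases (fib i) (fib (i + 2)) c (fib k) (fib (k ∸ 2))
      (0<fib (≤-trans 1≤i (m≤m+n i 2))) (≤-trans (0<fib (≤-trans 1≤i (m≤m+n i k))) (≤-reflexive (sym c≡)))
      (fib-coprime₂ i) identity public

  -- The five families of Fibonacci triples

  sylvester-a : ∀ i k → 3 ≤ i → i + 3 ≤ k →
    Σ[ N ∈ ℕ ] IsSylvesterNumber 3 (fib i ∷ fib (i + 2) ∷ fib (i + k) ∷ []) N ×
      2 * N + fib i + fib (i + 2) ≡ 7 * (fib i * fib (i + 2)) + 1
  -- Adding `g * a` turns the goal `4 * (g * a) ≤ c` into `5 * g * a ≤ q * b`, which splits into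
  -- `5 * g ≤ 2 * q` and `2 * a ≤ b`.
  sylvester-a i k 3≤i i+3≤k = number-far 4a≤q (+-cancelʳ-≤ (g * a) _ _ (begin
      4 * (g * a) + g * a     ≡⟨ solve 2 (λ g a → con 4 :* (g :* a) :+ g :* a := con 5 :* g :* a) refl g a ⟩
      5 * g * a               ≤⟨ *-monoˡ-≤ a 5g≤2q ⟩
      2 * q * a               ≡⟨ solve 2 (λ q a → con 2 :* q :* a := q :* (con 2 :* a)) refl q a ⟩
      q * (2 * a)             ≤⟨ *-monoʳ-≤ q (≤-trans (fib-double i) (≤-reflexive (cong fib (+-comm 2 i)))) ⟩
      q * fib (i + 2)         ≡⟨ sym identity ⟩
      fib (i + k) + g * a     ∎))
    where
    3≤k : 3 ≤ k
    3≤k = ≤-trans (m≤n+m 3 i) i+3≤k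
    open FibCases i k 3≤i 3≤k (fib (i + k)) refl
    open ≤-Reasoning
    a q g : ℕ
    a = fib i
    q = fib k
    g = fib (k ∸ 2)
    4a≤q : 4 * a ≤ q
    4a≤q = ≤-trans (quadruple i 3≤i) (fib-mono (≤-trans (≤-reflexive (+-comm 3 i)) i+3≤k))
      where
      quadruple : ∀ i → 3 ≤ i → 4 * fib i ≤ fib (3 + i)
      quadruple (suc (suc j)) (s≤s (s≤s _)) = ≤-shift (fib≤double j)
        (solve 2 (λ x y → con 4 :* (x :+ y) :+ con 2 :* x
            := x :+ y :+ x :+ (x :+ y) :+ (x :+ y :+ x) :+ (x :+ y)) refl (fib (1 + j)) (fib j))
    5g≤2q : 5 * g ≤ 2 * q
    5g≤2q = bound k (≤-trans (+-monoˡ-≤ 3 3≤i) i+3≤k)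
      where
      bound : ∀ k → 6 ≤ k → 5 * fib (k ∸ 2) ≤ 2 * fib k
      bound (suc (suc (suc (suc j)))) (s≤s (s≤s (s≤s (s≤s _)))) = ≤-shift (fib≤double j)
        (solve 2 (λ x y → con 5 :* (x :+ y) :+ con 2 :* x
            := con 2 :* (x :+ y :+ x :+ (x :+ y)) :+ (x :+ y)) refl (fib (1 + j)) (fib j))

  -- The hypothesis `8 * g ≤ b` of `separated` already fails at `i = 3`. With `q = a`, the weaker
  -- `5 * g ≤ b` is enough.
  sylvester-b : ∀ i → 3 ≤ i →
    Σ[ N ∈ ℕ ] IsSylvesterNumber 3 (fib i ∷ fib (i + 2) ∷ fib (2 * i) ∷ []) N ×
      2 * N + 4 * (fib i * fib (i ∸ 2)) + fib i + fib (i + 2) ≡ 5 * (fib i * fib (i + 2)) + 1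
  sylvester-b i@(suc (suc (suc j))) 3≤i@(s≤s (s≤s (s≤s _))) = number-equal (+-cancelʳ-≤ (g * a) _ _ (begin
      4 * (a * g) + g * a     ≡⟨ solve 2 (λ g a → con 4 :* (a :* g) :+ g :* a := a :* (con 5 :* g)) refl g a ⟩
      a * (5 * g)             ≤⟨ *-monoʳ-≤ a (≤-trans 5g≤ (≤-reflexive (cong fib (+-comm 2 i)))) ⟩
      a * fib (i + 2)         ≡⟨ sym identity ⟩
      fib (2 * i) + g * a     ∎)) refl
    where
    open FibCases i i 3≤i 3≤i (fib (2 * i)) (cong (λ n → fib (i + n)) (+-identityʳ i))
    open ≤-Reasoning
    a g : ℕ
    a = fib i
    g = fib (1 + j)
    5g≤ : 5 * g ≤ fib (2 + i)
    5g≤ = ≤-trans (m≤m+n (5 * g) (3 * fib j)) (≤-reflexive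
      (solve 2 (λ x y → con 5 :* x :+ con 3 :* y := x :+ y :+ x :+ (x :+ y) :+ (x :+ y :+ x)) refl g (fib j)))

  sylvester-c : ∀ i → 4 ≤ i →
    Σ[ N ∈ ℕ ] IsSylvesterNumber 3 (fib i ∷ fib (i + 2) ∷ fib (2 * i ∸ 1) ∷ []) N ×
      2 * N + 4 * (fib (i ∸ 1) * fib (i ∸ 3)) + fib i + fib (i + 2)
          ≡ fib i * fib (i + 2) + 1 + 4 * (fib (i ∸ 1) * fib (i + 2))
  sylvester-c i@(suc (suc (suc (suc j)))) 4≤i@(s≤s (s≤s (s≤s (s≤s _)))) = number-minus-one
      (separated identity 8g≤b 2g≤q (fib-mono (m≤m+n i 2)))
      (fib-mono (n≤1+n j))
      (solve 2 (λ g e → g :+ e :+ g := con 2 :* g :+ e) refl g e)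
      (solve 2 (λ g e → g :+ e :+ g :+ (g :+ e) := con 3 :* g :+ con 2 :* e) refl g e)
    where
    open FibCases i (i ∸ 1) (≤-trans (n≤1+n 3) 4≤i) (s≤s (s≤s (s≤s z≤n))) (fib (2 * i ∸ 1))
      (cong fib (trans (cong (_∸ 1) (cong (i +_) (+-identityʳ i))) (+-∸-assoc i (s≤s z≤n))))
    e g : ℕ
    e = fib j
    g = fib (1 + j)
    8g≤b : 8 * g ≤ fib (i + 2)
    8g≤b = ≤-trans (≤-trans (m≤m+n (8 * g) (5 * e)) (≤-reflexive
      (solve 2 (λ x y → con 8 :* x :+ con 5 :* y
        := x :+ y :+ x :+ (x :+ y) :+ (x :+ y :+ x) :+ (x :+ y :+ x :+ (x :+ y))) refl g e)))
            (≤-reflexive (cong fib (+-comm 2 i)))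
    2g≤q : 2 * g ≤ fib (3 + j)
    2g≤q = fib-double (1 + j)

  sylvester-d : ∀ i → 5 ≤ i →
    Σ[ N ∈ ℕ ] IsSylvesterNumber 3 (fib i ∷ fib (i + 2) ∷ fib (2 * i ∸ 2) ∷ []) N ×
      2 * N + 16 * (fib i * fib (i ∸ 4)) + fib i + fib (i + 2)
          ≡ 3 * (fib i * fib (i + 2)) + 1 + 30 * (fib (i ∸ 2) * fib (i ∸ 4))
  sylvester-d i@(suc (suc (suc (suc (suc j))))) 5≤i@(s≤s (s≤s (s≤s (s≤s (s≤s _))))) = number-minus-two
      (separated identity 8g≤b 2g≤q (fib-mono (m≤m+n i 2)))
      (solve 2 (λ g e → g :+ e :+ g := con 2 :* g :+ e) refl g e)
      (solve 2 (λ g e → g :+ e :+ g :+ (g :+ e) :+ (g :+ e :+ g) := con 5 :* g :+ con 3 :* e) refl g e)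
    where
    open FibCases i (i ∸ 2) (≤-trans (m≤n+m 3 2) 5≤i) (s≤s (s≤s (s≤s z≤n))) (fib (2 * i ∸ 2))
      (cong fib (trans (cong (_∸ 2) (cong (i +_) (+-identityʳ i))) (+-∸-assoc i (s≤s (s≤s z≤n)))))
    e g : ℕ
    e = fib j
    g = fib (1 + j)
    8g≤b : 8 * g ≤ fib (i + 2)
    8g≤b = ≤-trans (≤-trans (m≤m+n (8 * g) (5 * g + 8 * e)) (≤-reflexive
      (solve 2 (λ x y → con 8 :* x :+ (con 5 :* x :+ con 8 :* y)
        := x :+ y :+ x :+ (x :+ y) :+ (x :+ y :+ x) :+ (x :+ y :+ x :+ (x :+ y)) :+ (x :+ y :+ x :+ (x :+ y)
            :+ (x :+ y :+ x))) refl g e))) (≤-reflexive (cong fib (+-comm 2 i)))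
    2g≤q : 2 * g ≤ fib (3 + j)
    2g≤q = fib-double (1 + j)

  sylvester-e : ∀ i k → 3 ≤ i → (3≤k : 3 ≤ k) → ∀ m → _/_ (fib i ∸ 1) (fib k) {{fib-nonZero 3≤k}} ≡ 3 + m →
    Σ[ N ∈ ℕ ] IsSylvesterNumber 3 (fib i ∷ fib (i + 2) ∷ fib (i + k) ∷ []) N ×
      2 * N + 6 * (fib i * fib (k ∸ 2)) + 2 * (m * fib i * fib (k ∸ 2)) + fib i + fib (i + 2)
        ≡ fib i * fib (i + 2) + 1 + 6 * (fib k * fib (i + 2)) + m * (7 + m) * (fib k * fib (k ∸ 2))
  sylvester-e i k 3≤i 3≤k m r≡ = number-small
      (separated identity 8g≤b 2g≤q (fib-mono (m≤m+n i 2))) m {suc ((a ∸ 1) % q)} (m%n<n (a ∸ 1) q) a≡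
    where
    instance
      nonZero-q : NonZero (fib k)
      nonZero-q = fib-nonZero 3≤k
    open FibCases i k 3≤i 3≤k (fib (i + k)) refl
    open ≤-Reasoning
    a q g : ℕ
    a = fib i
    q = fib k
    g = fib (k ∸ 2)
    -- The quotient is that of `a - 1`, so the remainder part of `a` runs from 1 to `q`, with the
    -- value `q` when `q` divides `a`.
    a≡ : a ≡ (3 + m) * q + suc ((a ∸ 1) % q)
    a≡ = begin-equality
      a                                        ≡⟨ sym (m+[n∸m]≡n (0<fib (≤-trans (s≤s z≤n) 3≤i))) ⟩
      suc (a ∸ 1)                              ≡⟨ cong suc (m≡m%n+[m/n]*n (a ∸ 1) q) ⟩
      suc ((a ∸ 1) % q) + (a ∸ 1) / q * q      ≡⟨ cong (λ r → suc ((a ∸ 1) % q) + r * q) r≡ ⟩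
      suc ((a ∸ 1) % q) + (3 + m) * q          ≡⟨ +-comm (suc ((a ∸ 1) % q)) _ ⟩
      (3 + m) * q + suc ((a ∸ 1) % q)          ∎
    2g≤q : 2 * g ≤ q
    2g≤q = subst (λ n → 2 * g ≤ fib n) (m+[n∸m]≡n (≤-trans (n≤1+n 2) 3≤k)) (fib-double (k ∸ 2))
    8g≤b : 8 * g ≤ fib (i + 2)
    8g≤b = begin
      8 * g            ≡⟨ *-assoc 4 2 g ⟩
      4 * (2 * g)      ≤⟨ *-monoʳ-≤ 4 2g≤q ⟩
      4 * q            ≤⟨ *-monoˡ-≤ q (m≤m+n 4 2) ⟩
      6 * q            ≡⟨ *-assoc 2 3 q ⟩
      2 * (3 * q)      ≤⟨ *-monoʳ-≤ 2 (≤-trans (≤-trans (*-monoˡ-≤ q (m≤m+n 3 m)) (m≤m+n ((3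
          + m) * q) _)) (≤-reflexive (sym a≡))) ⟩
      2 * a            ≤⟨ fib-double i ⟩
      fib (2 + i)      ≡⟨ cong fib (+-comm 2 i) ⟩
      fib (i + 2)      ∎

-- Passage to the rational formulas

open import Data.Nat.DivMod using (_/_)
open import Data.Integer using (+_; _+_; _-_; _*_)
open import Data.Rational as ℚ using (½)
open import Data.Product using (_×_)
open import Data.Vec using (_∷_; [])
open import Function.Bundles using (_⇔_)

open import Algebra.Properties.AbelianGroup using (∙-cancelʳ)
open import Data.Integer using (ℤ)
open import Data.Integer.Properties using (pos-*; +-0-abelianGroup)
open import Data.Integer.Solver using (module +-*-Solver)
open import Data.Nat.Properties using (m+[n∸m]≡n)
open import Data.Product using (_,_; map₂)
open import Data.Rational using (ℚ; toℚᵘ)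
open import Data.Rational.Properties
  using (toℚᵘ-injective; toℚᵘ-fromℚᵘ; toℚᵘ-homo-+; toℚᵘ-homo-*; toℚᵘ-homo‿-)
open import Data.Rational.Unnormalised as ℚᵘ using (ℚᵘ; mkℚᵘ; *≡*; _≃_)
import Data.Rational.Unnormalised.Properties as ℚᵘ
open import Function using (_∘_)
open import Relation.Binary.PropositionalEquality using (_≡_; refl; sym; trans; cong; subst)
open +-*-Solver using (solve; _:=_; _:+_; _:*_; _:-_; :-_; con)

-- Normalisation by the gcd blocks computation in `ℚ` on variables. Over `ℚᵘ` an equation is a
-- cross-multiplied integer identity, within reach of the ring solver.
ιᵘ : ℤ → ℚᵘ
ιᵘ z = mkℚᵘ z 0

toℚᵘ-ι : ∀ z → toℚᵘ (ι z) ≃ ιᵘ z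
toℚᵘ-ι z = toℚᵘ-fromℚᵘ (ιᵘ z)

toℚᵘ-½ι : ∀ z → toℚᵘ (½ ℚ.* ι z) ≃ ℚᵘ.½ ℚᵘ.* ιᵘ z
toℚᵘ-½ι z = ℚᵘ.≃-trans (toℚᵘ-homo-* ½ (ι z)) (ℚᵘ.*-congˡ {ℚᵘ.½} (toℚᵘ-ι z))

toℚᵘ-∸ : ∀ p q {p′ q′} → toℚᵘ p ≃ p′ → toℚᵘ q ≃ q′ → toℚᵘ (p ℚ.- q) ≃ p′ ℚᵘ.- q′
toℚᵘ-∸ p q p≃ q≃ = ℚᵘ.≃-trans (toℚᵘ-homo-+ p (ℚ.- q))
  (ℚᵘ.+-cong p≃ (ℚᵘ.≃-trans (toℚᵘ-homo‿- q) (ℚᵘ.-‿cong q≃)))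

ι-half : ∀ N X → + 2 * N ≡ X → ι N ≡ ½ ℚ.* ι X
ι-half N X eq = toℚᵘ-injective (ℚᵘ.≃-trans (toℚᵘ-ι N) (ℚᵘ.≃-trans
  (*≡* (trans (solve 1 (λ N → N :* con (+ 2) := con (+ 1) :* (con (+ 2) :* N) :* con (+ 1)) refl N)
    (cong (λ X → + 1 * X * + 1) eq)))
  (ℚᵘ.≃-sym (toℚᵘ-½ι X))))

ι-half-minus : ∀ N X Y → + 2 * N ≡ X - + 2 * Y → ι N ≡ ½ ℚ.* ι X ℚ.- ι Y
ι-half-minus N X Y eq = toℚᵘ-injective (ℚᵘ.≃-trans (toℚᵘ-ι N) (ℚᵘ.≃-trans
  (*≡* (trans (solve 1 (λ N → N :* con (+ 2) := con (+ 2) :* N) refl N) (trans eq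
    (solve 2 (λ X Y → X :- con (+ 2) :* Y
        := (con (+ 1) :* X :* con (+ 1) :+ (:- Y) :* con (+ 2)) :* con (+ 1)) refl X Y))))
  (ℚᵘ.≃-sym (toℚᵘ-∸ (½ ℚ.* ι X) (ι Y) (toℚᵘ-½ι X) (toℚᵘ-ι Y)))))

ι-half-minus-half : ∀ N X Y Z → + 2 * N ≡ X - Y * Z → ι N ≡ ½ ℚ.* ι X ℚ.- ½ ℚ.* ι Y ℚ.* ι Z
ι-half-minus-half N X Y Z eq = toℚᵘ-injective (ℚᵘ.≃-trans (toℚᵘ-ι N) (ℚᵘ.≃-trans
  -- The difference of two halves has the unreduced denominator 4.
  (*≡* (trans (solve 1 (λ N → N :* con (+ 4) := con (+ 2) :* (con (+ 2) :* N)) refl N) (trans (cong (+ 2 *_) eq)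
    (solve 3 (λ X Y Z → con (+ 2) :* (X :- Y :* Z)
        := (con (+ 1) :* X :* con (+ 2) :+ (:- (con (+ 1) :* Y :* Z)) :* con (+ 2)) :* con (+ 1)) refl X Y Z))))
  (ℚᵘ.≃-sym (toℚᵘ-∸ (½ ℚ.* ι X) (½ ℚ.* ι Y ℚ.* ι Z) (toℚᵘ-½ι X)
    (ℚᵘ.≃-trans (toℚᵘ-homo-* (½ ℚ.* ι Y) (ι Z)) (ℚᵘ.*-cong (toℚᵘ-½ι Y) (toℚᵘ-ι Z)))))))

≡-shiftᶻ : ∀ {x y l r : ℤ} → l ≡ r → x + r ≡ y + l → x ≡ y
≡-shiftᶻ {x} {y} {l} refl eq = ∙-cancelʳ +-0-abelianGroup l x y eq

formula-a : ∀ a b N → 2 ℕ.* N ℕ.+ a ℕ.+ b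
    ≡ 7 ℕ.* (a ℕ.* b) ℕ.+ 1 →
  ι (+ N) ≡ ½ ℚ.* ι (+ 7 * + a * + b - + a - + b + + 1)
formula-a a b N eq = ι-half (+ N) (+ 7 * + a * + b - + a - + b + + 1)
    (≡-shiftᶻ lifted (identity (+ a) (+ b) (+ N)))
  where
  lifted : + 2 * + N + + a + + b ≡ + 7 * (+ a * + b) + + 1
  -- Casts commute with sums by computation; only products need rewriting, innermost first.
  lifted rewrite sym (pos-* a b) | sym (pos-* 7 (a ℕ.* b)) | sym (pos-* 2 N) = cong +_ eq
  identity : ∀ a b N → + 2 * N + (+ 7 * (a * b) + + 1) ≡ + 7 * a * b - a - b + + 1 + (+ 2 * N + a + b)
  identity = solve 3 (λ a b N → con (+ 2) :* N :+ (con (+ 7) :* (a :* b) :+ con (+ 1))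
      := con (+ 7) :* a :* b :- a :- b :+ con (+ 1) :+ (con (+ 2) :* N :+ a :+ b)) refl

formula-b : ∀ a b g N → 2 ℕ.* N ℕ.+ 4 ℕ.* (a ℕ.* g) ℕ.+ a ℕ.+ b
    ≡ 5 ℕ.* (a ℕ.* b) ℕ.+ 1 →
  ι (+ N) ≡ ½ ℚ.* ι ((+ 5 * + a - + 1) * + b - + a + + 1) ℚ.- ι (+ 2 * + a * + g)
formula-b a b g N eq = ι-half-minus (+ N) ((+ 5 * + a - + 1) * + b - + a + + 1) (+ 2 * + a * + g)
    (≡-shiftᶻ lifted (identity (+ a) (+ b) (+ g) (+ N)))
  where
  lifted : + 2 * + N + + 4 * (+ a * + g) + + a + + b ≡ + 5 * (+ a * + b) + + 1
  lifted rewrite sym (pos-* a b) | sym (pos-* 5 (a ℕ.* b)) | sym (pos-* a g) | sym (pos-* 4 (a ℕ.* g))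
      | sym (pos-* 2 N) = cong +_ eq
  identity : ∀ a b g N → + 2 * N + (+ 5 * (a * b) + + 1)
      ≡ (+ 5 * a - + 1) * b - a + + 1 - + 2 * (+ 2 * a * g) + (+ 2 * N + + 4 * (a * g) + a + b)
  identity = solve 4 (λ a b g N → con (+ 2) :* N :+ (con (+ 5) :* (a :* b) :+ con (+ 1))
      := (con (+ 5) :* a :- con (+ 1)) :* b :- a :+ con (+ 1) :- con (+ 2) :* (con (+ 2) :* a :* g)
      :+ (con (+ 2) :* N :+ con (+ 4) :* (a :* g) :+ a :+ b)) refl

formula-c : ∀ a b q g N → 2 ℕ.* N ℕ.+ 4 ℕ.* (q ℕ.* g) ℕ.+ a ℕ.+ b
    ≡ a ℕ.* b ℕ.+ 1 ℕ.+ 4 ℕ.* (q ℕ.* b) →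
  ι (+ N) ≡ ½ ℚ.* ι ((+ a + + 4 * + q - + 1) * + b - + a + + 1) ℚ.- ι (+ 2 * + q * + g)
formula-c a b q g N eq = ι-half-minus (+ N) ((+ a + + 4 * + q - + 1) * + b - + a + + 1) (+ 2 * + q * + g)
    (≡-shiftᶻ lifted (identity (+ a) (+ b) (+ q) (+ g) (+ N)))
  where
  lifted : + 2 * + N + + 4 * (+ q * + g) + + a + + b ≡ + a * + b + + 1 + + 4 * (+ q * + b)
  lifted rewrite sym (pos-* a b) | sym (pos-* q b) | sym (pos-* 4 (q ℕ.* b)) | sym (pos-* q g)
      | sym (pos-* 4 (q ℕ.* g)) | sym (pos-* 2 N) = cong +_ eq
  identity : ∀ a b q g N → + 2 * N + (a * b + + 1 + + 4 * (q * b))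
      ≡ (a + + 4 * q - + 1) * b - a + + 1 - + 2 * (+ 2 * q * g) + (+ 2 * N + + 4 * (q * g) + a + b)
  identity = solve 5 (λ a b q g N → con (+ 2) :* N :+ (a :* b :+ con (+ 1) :+ con (+ 4) :* (q :* b))
      := (a :+ con (+ 4) :* q :- con (+ 1)) :* b :- a :+ con (+ 1) :- con (+ 2) :* (con (+ 2) :* q :* g)
      :+ (con (+ 2) :* N :+ con (+ 4) :* (q :* g) :+ a :+ b)) refl

formula-d : ∀ a b q g N → 2 ℕ.* N ℕ.+ 16 ℕ.* (a ℕ.* g) ℕ.+ a ℕ.+ b
    ≡ 3 ℕ.* (a ℕ.* b) ℕ.+ 1 ℕ.+ 30 ℕ.* (q ℕ.* g) →
  ι (+ N) ≡ ½ ℚ.* ι ((+ 3 * + a - + 1) * + b - + a + + 1) ℚ.- ι ((+ 8 * + a - + 15 * + q) * + g)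
formula-d a b q g N eq = ι-half-minus (+ N) ((+ 3 * + a - + 1) * + b - + a + + 1) ((+ 8 * + a - + 15 * + q) * + g)
    (≡-shiftᶻ lifted (identity (+ a) (+ b) (+ q) (+ g) (+ N)))
  where
  lifted : + 2 * + N + + 16 * (+ a * + g) + + a + + b ≡ + 3 * (+ a * + b) + + 1 + + 30 * (+ q * + g)
  lifted rewrite sym (pos-* a b) | sym (pos-* 3 (a ℕ.* b)) | sym (pos-* q g) | sym (pos-* 30 (q ℕ.* g))
      | sym (pos-* a g) | sym (pos-* 16 (a ℕ.* g)) | sym (pos-* 2 N) = cong +_ eq
  identity : ∀ a b q g N → + 2 * N + (+ 3 * (a * b) + + 1 + + 30 * (q * g))
      ≡ (+ 3 * a - + 1) * b - a + + 1 - + 2 * ((+ 8 * a - + 15 * q) * g) + (+ 2 * N + + 16 * (a * g) + a + b)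
  identity = solve 5 (λ a b q g N → con (+ 2) :* N :+ (con (+ 3) :* (a :* b) :+ con (+ 1)
      :+ con (+ 30) :* (q :* g))
      := (con (+ 3) :* a :- con (+ 1)) :* b :- a :+ con (+ 1) :- con (+ 2) :* ((con (+ 8) :* a
      :- con (+ 15) :* q) :* g) :+ (con (+ 2) :* N :+ con (+ 16) :* (a :* g) :+ a :+ b)) refl

-- With `r` written as `3 + m`, the integer `r - 3` is the cast of the natural `m`.
formula-e : ∀ a b q g m N → 2 ℕ.* N ℕ.+ 6 ℕ.* (a ℕ.* g) ℕ.+ 2 ℕ.* (m ℕ.* a ℕ.* g) ℕ.+ a ℕ.+ b
    ≡ a ℕ.* b ℕ.+ 1 ℕ.+ 6 ℕ.* (q ℕ.* b) ℕ.+ m ℕ.* (7 ℕ.+ m) ℕ.* (q ℕ.* g) →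
  ι (+ N) ≡ ½ ℚ.* ι ((+ a + + 6 * + q - + 1) * + b - + a + + 1)
    ℚ.- ½ ℚ.* ι (+ 2 * + (3 ℕ.+ m) * + a - (+ (3 ℕ.+ m) + + 4) * (+ (3 ℕ.+ m) - + 3) * + q) ℚ.* ι (+ g)
formula-e a b q g m N eq = ι-half-minus-half (+ N) ((+ a + + 6 * + q - + 1) * + b - + a + + 1)
    (+ 2 * + (3 ℕ.+ m) * + a - (+ (3 ℕ.+ m) + + 4) * (+ (3 ℕ.+ m) - + 3) * + q) (+ g)
    (≡-shiftᶻ lifted (identity (+ a) (+ b) (+ q) (+ g) (+ m) (+ N)))
  where
  lifted : + 2 * + N + + 6 * (+ a * + g) + + 2 * (+ m * + a * + g) + + a + + b
      ≡ + a * + b + + 1 + + 6 * (+ q * + b) + + m * (+ 7 + + m) * (+ q * + g)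
  lifted rewrite sym (pos-* a b) | sym (pos-* q b) | sym (pos-* 6 (q ℕ.* b)) | sym (pos-* q g)
      | sym (pos-* m (7 ℕ.+ m)) | sym (pos-* (m ℕ.* (7 ℕ.+ m)) (q ℕ.* g)) | sym (pos-* a g)
      | sym (pos-* 6 (a ℕ.* g)) | sym (pos-* m a) | sym (pos-* (m ℕ.* a) g) | sym (pos-* 2 (m ℕ.* a ℕ.* g))
      | sym (pos-* 2 N) = cong +_ eq
  identity : ∀ a b q g m N → + 2 * N + (a * b + + 1 + + 6 * (q * b) + m * (+ 7 + m) * (q * g))
      ≡ (a + + 6 * q - + 1) * b - a + + 1 - (+ 2 * (+ 3 + m) * a - (+ 3 + m + + 4) * (+ 3 + m - + 3) * q) * g
      + (+ 2 * N + + 6 * (a * g) + + 2 * (m * a * g) + a + b)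
  identity = solve 6 (λ a b q g m N → con (+ 2) :* N :+ (a :* b :+ con (+ 1) :+ con (+ 6) :* (q :* b)
      :+ m :* (con (+ 7) :+ m) :* (q :* g))
      := (a :+ con (+ 6) :* q :- con (+ 1)) :* b :- a :+ con (+ 1) :- (con (+ 2) :* (con (+ 3) :+ m) :* a
      :- (con (+ 3) :+ m :+ con (+ 4)) :* (con (+ 3) :+ m :- con (+ 3)) :* q) :* g :+ (con (+ 2) :* N
      :+ con (+ 6) :* (a :* g) :+ con (+ 2) :* (m :* a :* g) :+ a :+ b)) refl

theorem12 : ∀ (i k : ℕ) → 3 ≤ i → (3≤k : 3 ≤ k) →
    (i ℕ.+ 3 ≤ k →
    SylvesterNumberEquals 3 (fib i ∷ fib (i ℕ.+ 2) ∷ fib (i ℕ.+ k) ∷ [])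
    (½ ℚ.* ι (+ 7 * F i * F (i ℕ.+ 2) - F i - F (i ℕ.+ 2) + + 1)))
    ×
    SylvesterNumberEquals 3 (fib i ∷ fib (i ℕ.+ 2) ∷ fib (2 ℕ.* i) ∷ [])
    (½ ℚ.* ι ((+ 5 * F i - + 1) * F (i ℕ.+ 2) - F i + + 1)
    ℚ.- ι (+ 2 * F i * F (i ∸ 2)))
    ×
    (4 ≤ i →
    SylvesterNumberEquals 3 (fib i ∷ fib (i ℕ.+ 2) ∷ fib (2 ℕ.* i ∸ 1) ∷ [])
    (½ ℚ.* ι ((F i + + 4 * F (i ∸ 1) - + 1) * F (i ℕ.+ 2) - F i + + 1)
    ℚ.- ι (+ 2 * F (i ∸ 1) * F (i ∸ 3))))
    ×
    (5 ≤ i →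
    SylvesterNumberEquals 3 (fib i ∷ fib (i ℕ.+ 2) ∷ fib (2 ℕ.* i ∸ 2) ∷ [])
    (½ ℚ.* ι ((+ 3 * F i - + 1) * F (i ℕ.+ 2) - F i + + 1)
    ℚ.- ι ((+ 8 * F i - + 15 * F (i ∸ 2)) * F (i ∸ 4))))
    ×
    (let r = _/_ (fib i ∸ 1) (fib k) {{fib-nonZero 3≤k}} in
    (3 ≤ r ⇔ k ≤ i ∸ 3)
    ×
    (3 ≤ r →
    SylvesterNumberEquals 3 (fib i ∷ fib (i ℕ.+ 2) ∷ fib (i ℕ.+ k) ∷ [])
    (½ ℚ.* ι ((F i + + 6 * F k - + 1) * F (i ℕ.+ 2) - F i + + 1)
    ℚ.- ½ ℚ.* ι (+ 2 * + r * F i - (+ r + + 4) * (+ r - + 3) * F k) ℚ.* ι (F (k ∸ 2)))))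
theorem12 i k 3≤i 3≤k =
    (λ i+3≤k → map₂ (λ {N} → map₂ (formula-a a b N)) (sylvester-a i k 3≤i i+3≤k))
  , map₂ (λ {N} → map₂ (formula-b a b (fib (i ∸ 2)) N)) (sylvester-b i 3≤i)
  , (λ 4≤i → map₂ (λ {N} → map₂ (formula-c a b (fib (i ∸ 1)) (fib (i ∸ 3)) N)) (sylvester-c i 4≤i))
  , (λ 5≤i → map₂ (λ {N} → map₂ (formula-d a b (fib (i ∸ 2)) (fib (i ∸ 4)) N)) (sylvester-d i 5≤i))
  , quotient≥3⇔ i k 3≤i 3≤k
  , λ 3≤r → map₂ (λ {N} → map₂ (subst (λ r → ι (+ N) ≡ value r) (m+[n∸m]≡n 3≤r) ∘ formula-e a b q g (r ∸ 3) N))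
      (sylvester-e i k 3≤i 3≤k (r ∸ 3) (sym (m+[n∸m]≡n 3≤r)))
  where
  a = fib i
  b = fib (i ℕ.+ 2)
  q = fib k
  g = fib (k ∸ 2)
  r = _/_ (fib i ∸ 1) (fib k) {{fib-nonZero 3≤k}}
  -- The motive for replacing `3 + (r ∸ 3)` by `r`.
  value : ℕ → ℚ
  value r = ½ ℚ.* ι ((+ a + + 6 * + q - + 1) * + b - + a + + 1)
    ℚ.- ½ ℚ.* ι (+ 2 * + r * + a - (+ r + + 4) * (+ r - + 3) * + q) ℚ.* ι (+ g)
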